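{- Let $\mathbb{F}_q$ be a finite field of odd characteristic, let $a,d\in\mathbb{F}_q$ with $ad(a-d)\neq 0$, let $E_{a,d}$ be the twisted Edwards curve $ax^2+y^2=1+dx^2y^2$, and let $w(x,y)=dx^2y^2$ on affine points and $w=\infty$ at the points at infinity. Put $e=4a/d$. Let $P_1,P_2\in E_{a,d}(\mathbb{F}_q)$, suppose that $w_0:=w(P_2-P_1)\in\mathbb{F}_q\setminus\{0\}$ (the difference is given in affine form), and let $(W_i,Z_i)\in\mathbb{F}_q^2\setminus\{(0,0)\}$ satisfy $w(P_i)=W_i/Z_i$ for $i=1,2$. Set $$A_1=W_1+Z_1,\quad B_1=W_1-Z_1,\quad A_2=W_2+Z_2,\quad B_2=W_2-Z_2,\quad C=A_1B_2,\quad D=A_2B_1,$$ $$W_3=(C-D)^2,\qquad Z_3=w_0(C+D)^2,$$ and compute $(W_4,Z_4)$ in any one of the following ways: (i) $E=A_1^2-B_1^2$, $W_4=E\left(A_1^2-\tfrac{e}{4}E\right)$, $Z_4=A_1^2B_1^2$; (ii) $E=A_1^2-B_1^2$, $F=(A_1^4+B_1^4)-E^2$, $W_4=2\left(A_1^4-\tfrac e4E^2\right)-F$, $Z_4=F$; (iii) if $e(e-4)$ is a nonzero square in $\mathbb{F}_q$ (equivalently $\chi(a(a-d))=1$), with $r\in\mathbb{F}_q$ such that $r^2=(e-4)/e$: $H_1=(rA_1^2+B_1^2)^2$, $H_2=(rA_1^2-B_1^2)^2$, $G=H_1+H_2$, $K=H_1-H_2$, $S=\tfrac1rK$, $T=rK$,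 $W_4=2G-S-T$, $Z_4=T-S$. Then in each case $w(2P_1)=W_4/Z_4$ and $w(P_1+P_2)=W_3/Z_3$ (neither pair being $(0,0)$). The total cost of computing $(W_3,Z_3)$ and $(W_4,Z_4)$ from $w_0,W_1,Z_1,W_2,Z_2$ is $5\mathbf{M}+4\mathbf{S}+1\mathbf{D}$ in case (i), $3\mathbf{M}+7\mathbf{S}+1\mathbf{D}$ in case (ii), and $3\mathbf{M}+6\mathbf{S}+3\mathbf{D}$ in case (iii).
   Context: $\chi$ denotes the quadratic character of $\mathbb{F}_q$. $\mathbf{M}$, $\mathbf{S}$, $\mathbf{D}$ denote the cost of one multiplication in $\mathbb{F}_q$, one squaring in $\mathbb{F}_q$, and one multiplication by a curve constant (here $e/4$, or $r$ and $1/r$); additions, subtractions and multiplications by the integer $2$ are not counted. The nonsingular model of $E_{a,d}$ is the curve in $\mathbb{P}^3$ of points $(X:Y:T:Z)$ with $aX^2+Y^2=Z^2+dT^2$ and $XY=ZT$; an affine point $(x,y)$ corresponds to $(x:y:xy:1)$. The points with $Z=0$ ("points at infinity") are $(0:\pm\sqrt d:1:0)$ and $(1:0:\pm\sqrt{a/d}:0)$, when rational. $E_{a,d}(\mathbb{F}_q)$ is the set of $\mathbb{F}_q$-rational points of this model; it is a group with neutral element $\mathcal{O}=(0,1)$, $-(x,y)=(-x,y)$ (in $\mathbb{P}^3$: $-(X:Y:T:Z)=(-X:Y:-T:Z)$), whose (elliptic curve) group law is given on affine points, whenever the denominators are nonzero, by $(x_1,y_1)+(x_2,y_2)=\left(\frac{x_1y_2+x_2y_1}{1+dx_1x_2y_1y_2},\frac{y_1y_2-ax_1x_2}{1-dx_1x_2y_1y_2}\right)$.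 $W/Z$ means the quotient in $\mathbb{F}_q$ if $Z\ne0$, it means $\infty$ if $W\neq0$ and $Z=0$, and it is undefined if $W=Z=0$. -}

module Defs where

open import Algebra.Bundles using (CommutativeRing; RawRing)
import Algebra.Definitions
import Algebra.Properties.AbelianGroup
import Algebra.Properties.Ring
import Algebra.Properties.Semiring.Mult
import Algebra.Solver.Ring
open import Algebra.Solver.Ring.AlmostCommutativeRing
  using (fromCommutativeRing; _-Raw-AlmostCommutative⟶_)
open import Data.Bool.Base using (Bool; true; false; _∧_; if_then_else_)
open import Data.Empty using (⊥; ⊥-elim)
open import Data.Fin.Base using (Fin; zero; suc)
import Data.Fin.Properties as Fin
open import Data.Integer.Base using (ℤ; 0ℤ; 1ℤ; -1ℤ)
open import Data.List.Base using (List; []; _∷_; _++_; concatMap; deduplicateᵇ)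
open import Data.Maybe.Base using (Maybe; just; nothing)
open import Data.Nat.Base as ℕ using (ℕ)
open import Data.Nat.Divisibility using (_∣_; divides; ∣1⇒≡1; ∣-refl)
import Data.Nat.Properties as ℕ
open import Data.Product using (_×_; _,_; ∃; ∃-syntax; proj₁; proj₂)
open import Data.Sum using (_⊎_; inj₁; inj₂)
open import Data.Vec.Base using (Vec; []; _∷_; lookup)
open import Function.Bundles using (Inverse; _⇔_; Equivalence)
open import Function.Properties.Inverse using (Inverse⇒Injection)
open import Level using (Level; _⊔_) renaming (suc to lsuc)
open import Relation.Binary.PropositionalEquality as ≡ using (_≡_)
import Relation.Binary.Construct.Add.Point.Equality
open import Relation.Nullary using (¬_; Dec; yes; no; does)
open import Relation.Nullary.Decidable using (_×-dec_; map′)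
open import Relation.Nullary.Construct.Add.Point using (Pointed)
  renaming (∙ to ∞; [_] to fin)

------------------------------------------------------------------------

record FiniteField (c ℓ : Level) : Set (lsuc (c ⊔ ℓ)) where
  field
    commutativeRing : CommutativeRing c ℓ

  open CommutativeRing commutativeRing public
  open Algebra.Definitions _≈_ using (Invertible)

  field
    0≉1                : 0# ≉ 1#
    nonzero⇒invertible : ∀ x → x ≉ 0# → Invertible 1# _*_ x
    q                  : ℕ
    enumeration        : Inverse setoid (≡.setoid (Fin q))

  open Algebra.Properties.Semiring.Mult semiring public
    using () renaming (_×_ to _·ℕ_)

  open Inverse enumeration public
    using () renaming (from to element; to to index; strictlyInverseʳ to element-index)

  infix 4 _≟_
  _≟_ : ∀ x y → Dec (x ≈ y)
  _≟_ = Fin.inj⇒≟ (Inverse⇒Injection enumeration)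

  -- 0 ⁻¹ = 0 is a dummy value.
  infix 9 _⁻¹
  _⁻¹ : Carrier → Carrier
  x ⁻¹ with x ≟ 0#
  ... | yes _   = 0#
  ... | no  x≉0 = proj₁ (nonzero⇒invertible x x≉0)

  infixl 7 _/_
  _/_ : Carrier → Carrier → Carrier
  x / y = x * y ⁻¹

  infix 9 _²
  _² : Carrier → Carrier
  x ² = x * x

  IsSquare IsNonzeroSquare : Carrier → Set (c ⊔ ℓ)
  IsSquare        x = ∃[ y ] y ² ≈ x
  IsNonzeroSquare x = x ≉ 0# × IsSquare x

  isSquare? : ∀ x → Dec (IsSquare x)
  isSquare? x = map′
    (λ (i , eq) → element i , eq)
    (λ (y , eq) → index y , trans (*-cong (element-index y) (element-index y)) eq)
    (Fin.any? λ i → element i ² ≟ x)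

  χ : Carrier → ℤ
  χ x = if does (x ≟ 0#) then 0ℤ else if does (isSquare? x) then 1ℤ else -1ℤ

  HasCharacteristic : ℕ → Set ℓ
  HasCharacteristic p = ∀ n → (n ·ℕ 1# ≈ 0#) ⇔ (p ∣ n)

  OddCharacteristic : Set ℓ
  OddCharacteristic = ∃[ p ] (HasCharacteristic p × ¬ (2 ∣ p))

------------------------------------------------------------------------
-- A normaliser for commutative ring identities.  The coefficient (m , n)
-- stands for m − n; reduce makes it canonical.

module RingSolver {c ℓ} (R : CommutativeRing c ℓ) where
  open CommutativeRing R
  open Algebra.Properties.Semiring.Mult semiring
    using (×-homo-+; ×1-homo-*) renaming (_×_ to _·_; ×-congˡ to ·-congˡ)
  open Algebra.Properties.Ring ring using (-‿distribˡ-*; -‿distribʳ-*)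
  open Algebra.Properties.AbelianGroup +-abelianGroup using (⁻¹-∙-comm; ⁻¹-involutive; ε⁻¹≈ε)
  open import Relation.Binary.Reasoning.Setoid setoid

  private
    interchange : ∀ w x y z → (w + x) + (y + z) ≈ (w + y) + (x + z)
    interchange w x y z = begin
      (w + x) + (y + z)  ≈⟨ +-assoc w x (y + z) ⟩
      w + (x + (y + z))  ≈⟨ +-congˡ (sym (+-assoc x y z)) ⟩
      w + ((x + y) + z)  ≈⟨ +-congˡ (+-congʳ (+-comm x y)) ⟩
      w + ((y + x) + z)  ≈⟨ +-congˡ (+-assoc y x z) ⟩
      w + (y + (x + z))  ≈⟨ sym (+-assoc w y (x + z)) ⟩
      (w + y) + (x + z)  ∎

    sub-+ : ∀ w x y z → (w + x) - (y + z) ≈ (w - y) + (x - z)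
    sub-+ w x y z = trans (+-congˡ (sym (⁻¹-∙-comm y z))) (interchange w x (- y) (- z))

    -- (w − x)(y − z) = (wy + xz) − (wz + xy)
    sub-* : ∀ w x y z → (w - x) * (y - z) ≈ (w * y + x * z) - (w * z + x * y)
    sub-* w x y z = begin
      (w - x) * (y - z)
        ≈⟨ distribʳ (y - z) w (- x) ⟩
      w * (y - z) + - x * (y - z)
        ≈⟨ +-cong (distribˡ w y (- z)) (distribˡ (- x) y (- z)) ⟩
      (w * y + w * - z) + (- x * y + - x * - z)
        ≈⟨ +-cong (+-congˡ (sym (-‿distribʳ-* w z)))
             (trans (+-comm _ _) (+-cong
               (trans (sym (-‿distribˡ-* x (- z)))
                 (trans (-‿cong (sym (-‿distribʳ-* x z))) (⁻¹-involutive (x * z))))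
               (sym (-‿distribˡ-* x y)))) ⟩
      (w * y - w * z) + (x * z - x * y)
        ≈⟨ sym (sub-+ (w * y) (x * z) (w * z) (x * y)) ⟩
      (w * y + x * z) - (w * z + x * y) ∎

    neg-sub : ∀ x y → y - x ≈ - (x - y)
    neg-sub x y = sym (trans (sym (⁻¹-∙-comm x (- y)))
      (trans (+-congˡ (⁻¹-involutive y)) (+-comm (- x) y)))

    cross : ∀ w x y z → w + z ≈ y + x → w - x ≈ y - z
    cross w x y z eq = begin
      w - x                    ≈⟨ sym (+-identityʳ (w - x)) ⟩
      (w - x) + 0#             ≈⟨ +-congˡ (sym (-‿inverseʳ z)) ⟩
      (w - x) + (z - z)        ≈⟨ interchange w (- x) z (- z) ⟩
      (w + z) + (- x - z)      ≈⟨ +-congʳ eq ⟩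
      (y + x) + (- x - z)      ≈⟨ interchange y x (- x) (- z) ⟩
      (y - x) + (x - z)        ≈⟨ interchange y (- x) x (- z) ⟩
      (y + x) + (- x - z)      ≈⟨ +-congˡ (+-comm (- x) (- z)) ⟩
      (y + x) + (- z - x)      ≈⟨ interchange y x (- z) (- x) ⟩
      (y - z) + (x - x)        ≈⟨ +-congˡ (-‿inverseʳ x) ⟩
      (y - z) + 0#             ≈⟨ +-identityʳ (y - z) ⟩
      y - z                    ∎

    value : ℕ × ℕ → Carrier
    value (m , n) = m · 1# - n · 1#

    reduce : ℕ → ℕ → ℕ × ℕ
    reduce (ℕ.suc m) (ℕ.suc n) = reduce m n
    reduce m         n         = m , n

    value-reduce : ∀ m n → value (reduce m n) ≈ value (m , n)
    value-reduce ℕ.zero    n         = refl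
    value-reduce (ℕ.suc m) ℕ.zero    = refl
    value-reduce (ℕ.suc m) (ℕ.suc n) = trans (value-reduce m n)
      (cross (m · 1#) (n · 1#) (1# + m · 1#) (1# + n · 1#)
        (trans (sym (+-assoc (m · 1#) 1# (n · 1#))) (+-congʳ (+-comm (m · 1#) 1#))))

    Coeff : RawRing _ _
    Coeff = record
      { Carrier = ℕ × ℕ
      ; _≈_     = _≡_
      ; _+_     = λ (m , n) (m′ , n′) → reduce (m ℕ.+ m′) (n ℕ.+ n′)
      ; _*_     = λ (m , n) (m′ , n′) → reduce (m ℕ.* m′ ℕ.+ n ℕ.* n′) (m ℕ.* n′ ℕ.+ n ℕ.* m′)
      ; -_      = λ (m , n) → n , m
      ; 0#      = 0 , 0
      ; 1#      = 1 , 0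
      }

    prod-sum : ∀ k l m n → (k ℕ.* l ℕ.+ m ℕ.* n) · 1# ≈
                           (k · 1#) * (l · 1#) + (m · 1#) * (n · 1#)
    prod-sum k l m n = trans (×-homo-+ 1# (k ℕ.* l) (m ℕ.* n))
                             (+-cong (×1-homo-* k l) (×1-homo-* m n))

    morphism : Coeff -Raw-AlmostCommutative⟶ fromCommutativeRing R
    morphism = record
      { ⟦_⟧    = value
      ; +-homo = λ (m , n) (m′ , n′) → trans (value-reduce (m ℕ.+ m′) (n ℕ.+ n′))
          (trans (+-cong (×-homo-+ 1# m m′) (-‿cong (×-homo-+ 1# n n′)))
                 (sub-+ (m · 1#) (m′ · 1#) (n · 1#) (n′ · 1#)))
      ; *-homo = λ (m , n) (m′ , n′) →
          trans (value-reduce (m ℕ.* m′ ℕ.+ n ℕ.* n′) (m ℕ.* n′ ℕ.+ n ℕ.* m′))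
          (trans (+-cong (prod-sum m m′ n n′) (-‿cong (prod-sum m n′ n m′)))
                 (sym (sub-* (m · 1#) (n · 1#) (m′ · 1#) (n′ · 1#))))
      ; -‿homo = λ (m , n) → neg-sub (m · 1#) (n · 1#)
      ; 0-homo = -‿inverseʳ 0#
      ; 1-homo = trans (+-cong (+-identityʳ 1#) ε⁻¹≈ε) (+-identityʳ 1#)
      }

    _≟c_ : ∀ x y → Maybe (value x ≈ value y)
    (m , n) ≟c (m′ , n′) with m ℕ.+ n′ ℕ.≟ m′ ℕ.+ n
    ... | no  _  = nothing
    ... | yes eq = just (cross (m · 1#) (n · 1#) (m′ · 1#) (n′ · 1#)
                     (trans (sym (×-homo-+ 1# m n′))
                            (trans (·-congˡ eq) (×-homo-+ 1# m′ n))))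

  open Algebra.Solver.Ring Coeff (fromCommutativeRing R) morphism _≟c_ public
    using (solve; _:=_; _:+_; _:*_; _:-_; :-_; con)

------------------------------------------------------------------------

module FieldProperties {c ℓ} (F : FiniteField c ℓ) where
  open FiniteField F
  open import Relation.Binary.Reasoning.Setoid setoid

  *-zero-product : ∀ {x y} → x * y ≈ 0# → x ≈ 0# ⊎ y ≈ 0#
  *-zero-product {x} {y} xy≈0 with x ≟ 0#
  ... | yes x≈0 = inj₁ x≈0
  ... | no  x≉0 with nonzero⇒invertible x x≉0
  ...   | x⁻¹ , x⁻¹x≈1 , _ = inj₂ (begin
    y              ≈⟨ *-identityˡ y ⟨
    1# * y         ≈⟨ *-congʳ x⁻¹x≈1 ⟨
    x⁻¹ * x * y    ≈⟨ *-assoc x⁻¹ x y ⟩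
    x⁻¹ * (x * y)  ≈⟨ *-congˡ xy≈0 ⟩
    x⁻¹ * 0#       ≈⟨ zeroʳ x⁻¹ ⟩
    0#             ∎)

  *-cancel-0 : ∀ {x y} → x ≉ 0# → x * y ≈ 0# → y ≈ 0#
  *-cancel-0 x≉0 xy≈0 with *-zero-product xy≈0
  ... | inj₁ x≈0 = ⊥-elim (x≉0 x≈0)
  ... | inj₂ y≈0 = y≈0

  ²-zero : ∀ {x} → x ² ≈ 0# → x ≈ 0#
  ²-zero x²≈0 with *-zero-product x²≈0
  ... | inj₁ x≈0 = x≈0
  ... | inj₂ x≈0 = x≈0

  *0 : ∀ {x y} → y ≈ 0# → x * y ≈ 0#
  *0 {x} y≈0 = trans (*-congˡ y≈0) (zeroʳ x)

  0* : ∀ {x y} → x ≈ 0# → x * y ≈ 0#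
  0* {y = y} x≈0 = trans (*-congʳ x≈0) (zeroˡ y)

  0+0 : ∀ {x y} → x ≈ 0# → y ≈ 0# → x + y ≈ 0#
  0+0 x≈0 y≈0 = trans (+-cong x≈0 y≈0) (+-identityʳ 0#)

  0-0 : ∀ {x y} → x ≈ 0# → y ≈ 0# → x - y ≈ 0#
  0-0 x≈0 y≈0 = trans (+-cong x≈0 (-‿cong y≈0)) (-‿inverseʳ 0#)

  ≈⇒-≈0 : ∀ {x y} → x ≈ y → x - y ≈ 0#
  ≈⇒-≈0 {y = y} x≈y = trans (+-congʳ x≈y) (-‿inverseʳ y)

  neg-zero : ∀ {x} → - x ≈ 0# → x ≈ 0#
  neg-zero {x} -x≈0 = trans (sym (+-identityʳ x)) (trans (+-congˡ (sym -x≈0)) (-‿inverseʳ x))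

  double-zero : OddCharacteristic → ∀ {x} → x + x ≈ 0# → x ≈ 0#
  double-zero (p , char , 2∤p) {x} x+x≈0 with 1# + 1# ≟ 0#
  ... | no 2≉0 = *-cancel-0 2≉0
    (trans (distribʳ x 1# 1#) (trans (+-cong (*-identityˡ x) (*-identityˡ x)) x+x≈0))
  ... | yes 2≈0 = ⊥-elim (impossible (Equivalence.to (char 2)
                    (trans (+-congˡ (+-identityʳ 1#)) 2≈0)))
    where
    impossible : p ∣ 2 → ⊥
    impossible (divides 0 ())
    impossible (divides 1 2≡p) = 2∤p (≡.subst (2 ∣_) (≡.trans 2≡p (ℕ.+-identityʳ p)) ∣-refl)
    impossible (divides (ℕ.suc (ℕ.suc k)) 2≡kp) = p≢1 (p≡1 p (≡.trans 2≡kp ≡.refl))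
      where
      p≢1 : ¬ (p ≡ 1)
      p≢1 ≡.refl = 0≉1 (sym (trans (sym (+-identityʳ 1#)) (Equivalence.from (char 1) ∣-refl)))
      p≡1 : ∀ m → 2 ≡ m ℕ.+ (m ℕ.+ k ℕ.* m) → m ≡ 1
      p≡1 0 eq = ⊥-elim (0≢2 (≡.trans (≡.sym (ℕ.*-zeroʳ k)) (≡.sym eq)))
        where
        0≢2 : ¬ (0 ≡ 2)
        0≢2 ()
      p≡1 1 _ = ≡.refl
      p≡1 (ℕ.suc (ℕ.suc m)) eq with ≡.trans (ℕ.suc-injective (ℕ.suc-injective eq))
                                     (≡.trans (≡.cong (m ℕ.+_) ≡.refl) (ℕ.+-suc m _))
      ... | ()

Nonsingular : ∀ {c ℓ} (F : FiniteField c ℓ) (a d : FiniteField.Carrier F) → Set ℓ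
Nonsingular F a d = a * d * (a - d) ≉ 0#
  where open FiniteField F

module TwistedEdwards {c ℓ} (F : FiniteField c ℓ) (odd : FiniteField.OddCharacteristic F)
  (a d : FiniteField.Carrier F) (nonsingular : Nonsingular F a d) where

  open FiniteField F
  open FieldProperties F
  open RingSolver commutativeRing
  open import Relation.Binary.Reasoning.Setoid setoid

  record Coordinates : Set c where
    constructor ⟨_∶_∶_∶_⟩
    field X Y T Z : Carrier

  IsZero : Coordinates → Set ℓ
  IsZero ⟨ X ∶ Y ∶ T ∶ Z ⟩ = X ≈ 0# × Y ≈ 0# × T ≈ 0# × Z ≈ 0#

  isZero? : ∀ v → Dec (IsZero v)
  isZero? ⟨ X ∶ Y ∶ T ∶ Z ⟩ = X ≟ 0# ×-dec Y ≟ 0# ×-dec T ≟ 0# ×-dec Z ≟ 0#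

  OnCurve : Coordinates → Set ℓ
  OnCurve ⟨ X ∶ Y ∶ T ∶ Z ⟩ = (a * X ² + Y ² ≈ Z ² + d * T ²) × (X * Y ≈ Z * T)

  -- A rational point of the curve in ℙ³, given by any one of its coordinate
  -- vectors; w, ⊖ and ⊕ do not depend on the choice up to rescaling.
  record Point : Set (c ⊔ ℓ) where
    field
      coordinates : Coordinates
      nonzero     : ¬ IsZero coordinates
      onCurve     : OnCurve coordinates
    open Coordinates coordinates public

  open Point using (coordinates)

  -- For affine points x = X/Z, y = Y/Z with XY = ZT, the fractions
  -- x₃ = (x₁y₂+x₂y₁)/(1+dx₁x₂y₁y₂) and y₃ = (y₁y₂−ax₁x₂)/(1−dx₁x₂y₁y₂)
  -- are U/N and V/M, and law₁ is (x₃ : y₃ : x₃y₃ : 1) cleared of denominators.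
  law₁ : Coordinates → Coordinates → Coordinates
  law₁ ⟨ X₁ ∶ Y₁ ∶ T₁ ∶ Z₁ ⟩ ⟨ X₂ ∶ Y₂ ∶ T₂ ∶ Z₂ ⟩ = ⟨ U * M ∶ V * N ∶ U * V ∶ N * M ⟩
    where
    U = X₁ * Y₂ + Y₁ * X₂
    V = Y₁ * Y₂ - a * X₁ * X₂
    N = Z₁ * Z₂ + d * T₁ * T₂
    M = Z₁ * Z₂ - d * T₁ * T₂

  -- Likewise for the dual formulas of the same group law,
  -- x₃ = (x₁y₁+x₂y₂)/(y₁y₂+ax₁x₂) and y₃ = (x₁y₁−x₂y₂)/(x₁y₂−y₁x₂).
  law₂ : Coordinates → Coordinates → Coordinates
  law₂ ⟨ X₁ ∶ Y₁ ∶ T₁ ∶ Z₁ ⟩ ⟨ X₂ ∶ Y₂ ∶ T₂ ∶ Z₂ ⟩ = ⟨ U * M ∶ V * N ∶ U * V ∶ N * M ⟩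
    where
    U = T₁ * Z₂ + Z₁ * T₂
    V = T₁ * Z₂ - Z₁ * T₂
    N = Y₁ * Y₂ + a * X₁ * X₂
    M = X₁ * Y₂ - Y₁ * X₂

  private
    segre : ∀ U V N M → (U * M) * (V * N) ≈ (N * M) * (U * V)
    segre = solve 4 (λ U V N M → (U :* M) :* (V :* N) := (N :* M) :* (U :* V)) refl

    -- (Y² − aX²)² = (aX² + Y²)² − 4a(XY)²
    α² : ∀ X Y → (Y ² - a * X ²) ² + (a * (X * Y) ² + a * (X * Y) ²)
                   + (a * (X * Y) ² + a * (X * Y) ²) ≈ (a * X ² + Y ²) ²
    α² X Y = solve 3 (λ a X Y →
        let s = a :* ((X :* Y) :* (X :* Y)); α = Y :* Y :- a :* (X :* X); S = a :* (X :* X) :+ Y :* Y in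
        α :* α :+ (s :+ s) :+ (s :+ s) := S :* S) refl a X Y

  law₁-onCurve : ∀ P Q → OnCurve P → OnCurve Q → OnCurve (law₁ P Q)
  law₁-onCurve ⟨ X₁ ∶ Y₁ ∶ T₁ ∶ Z₁ ⟩ ⟨ X₂ ∶ Y₂ ∶ T₂ ∶ Z₂ ⟩ (c₁ , s₁) (c₂ , s₂) = eq , segre U V N M
    where
    U V N M S₁ S₂ σ₁ σ₂ α₁ α₂ p t : Carrier
    U = X₁ * Y₂ + Y₁ * X₂
    V = Y₁ * Y₂ - a * X₁ * X₂
    N = Z₁ * Z₂ + d * T₁ * T₂
    M = Z₁ * Z₂ - d * T₁ * T₂
    S₁ = a * X₁ ² + Y₁ ²
    S₂ = a * X₂ ² + Y₂ ²
    σ₁ = X₁ * Y₁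
    σ₂ = X₂ * Y₂
    α₁ = Y₁ ² - a * X₁ ²
    α₂ = Y₂ ² - a * X₂ ²
    p = Z₁ * Z₂
    t = d * T₁ * T₂

    expand : a * (U * M) ² + (V * N) ² ≈
             (a * U ² + V ²) * (p ² + t ²) + (p * t + p * t) * (V ² - a * U ²)
    expand = solve 5 (λ a U V p t →
      let M = p :- t; N = p :+ t in
      a :* ((U :* M) :* (U :* M)) :+ (V :* N) :* (V :* N) :=
      (a :* (U :* U) :+ V :* V) :* (p :* p :+ t :* t) :+ (p :* t :+ p :* t) :* (V :* V :- a :* (U :* U)))
      refl a U V p t

    norm : a * U ² + V ² ≈ S₁ * S₂
    norm = solve 5 (λ a X₁ Y₁ X₂ Y₂ →
      let U = X₁ :* Y₂ :+ Y₁ :* X₂; V = Y₁ :* Y₂ :- a :* X₁ :* X₂ in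
      a :* (U :* U) :+ V :* V := (a :* (X₁ :* X₁) :+ Y₁ :* Y₁) :* (a :* (X₂ :* X₂) :+ Y₂ :* Y₂))
      refl a X₁ Y₁ X₂ Y₂

    norm⁻ : V ² - a * U ² ≈ α₁ * α₂ - (a * σ₁ * σ₂ + a * σ₁ * σ₂ + (a * σ₁ * σ₂ + a * σ₁ * σ₂))
    norm⁻ = solve 5 (λ a X₁ Y₁ X₂ Y₂ →
      let U = X₁ :* Y₂ :+ Y₁ :* X₂; V = Y₁ :* Y₂ :- a :* X₁ :* X₂
          s = a :* (X₁ :* Y₁) :* (X₂ :* Y₂) in
      V :* V :- a :* (U :* U) :=
      (Y₁ :* Y₁ :- a :* (X₁ :* X₁)) :* (Y₂ :* Y₂ :- a :* (X₂ :* X₂)) :- (s :+ s :+ (s :+ s)))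
      refl a X₁ Y₁ X₂ Y₂

    pt : p * t ≈ d * σ₁ * σ₂
    pt = begin
      p * t                            ≈⟨ solve 5 (λ d T₁ Z₁ T₂ Z₂ →
                                            (Z₁ :* Z₂) :* (d :* T₁ :* T₂) := d :* (Z₁ :* T₁) :* (Z₂ :* T₂))
                                            refl d T₁ Z₁ T₂ Z₂ ⟩
      d * (Z₁ * T₁) * (Z₂ * T₂)        ≈⟨ *-cong (*-congˡ s₁) s₂ ⟨
      d * σ₁ * σ₂                      ∎

    UV : U * V ≈ σ₁ * α₂ + σ₂ * α₁
    UV = solve 5 (λ a X₁ Y₁ X₂ Y₂ →
      (X₁ :* Y₂ :+ Y₁ :* X₂) :* (Y₁ :* Y₂ :- a :* X₁ :* X₂) :=
      (X₁ :* Y₁) :* (Y₂ :* Y₂ :- a :* (X₂ :* X₂)) :+ (X₂ :* Y₂) :* (Y₁ :* Y₁ :- a :* (X₁ :* X₁)))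
      refl a X₁ Y₁ X₂ Y₂

    core : S₁ * S₂ * (p ² + t ²) ≈ (N * M) ² + (d * σ₁ ² * S₂ ² + d * σ₂ ² * S₁ ²)
    core = begin
      S₁ * S₂ * (p ² + t ²)
        ≈⟨ *-congʳ (*-cong c₁ c₂) ⟩
      (Z₁ ² + d * T₁ ²) * (Z₂ ² + d * T₂ ²) * (p ² + t ²)
        ≈⟨ solve 5 (λ d T₁ Z₁ T₂ Z₂ →
             let S₁ = Z₁ :* Z₁ :+ d :* (T₁ :* T₁); S₂ = Z₂ :* Z₂ :+ d :* (T₂ :* T₂)
                 p = Z₁ :* Z₂; t = d :* T₁ :* T₂; s₁ = Z₁ :* T₁; s₂ = Z₂ :* T₂
                 NM = (p :+ t) :* (p :- t) in
             S₁ :* S₂ :* (p :* p :+ t :* t) :=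
             NM :* NM :+ (d :* (s₁ :* s₁) :* (S₂ :* S₂) :+ d :* (s₂ :* s₂) :* (S₁ :* S₁)))
             refl d T₁ Z₁ T₂ Z₂ ⟩
      (N * M) ² + (d * (Z₁ * T₁) ² * (Z₂ ² + d * T₂ ²) ² + d * (Z₂ * T₂) ² * (Z₁ ² + d * T₁ ²) ²)
        ≈⟨ +-congˡ (+-cong
             (*-cong (*-congˡ (*-cong s₁ s₁)) (*-cong c₂ c₂))
             (*-cong (*-congˡ (*-cong s₂ s₂)) (*-cong c₁ c₁))) ⟨
      (N * M) ² + (d * σ₁ ² * S₂ ² + d * σ₂ ² * S₁ ²) ∎

    eq : a * (U * M) ² + (V * N) ² ≈ (N * M) ² + d * (U * V) ²
    eq = begin
      a * (U * M) ² + (V * N) ²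
        ≈⟨ expand ⟩
      (a * U ² + V ²) * (p ² + t ²) + (p * t + p * t) * (V ² - a * U ²)
        ≈⟨ +-cong (*-congʳ norm) (*-cong (+-cong pt pt) norm⁻) ⟩
      S₁ * S₂ * (p ² + t ²) + (δ + δ) * (α₁ * α₂ - (β + β + (β + β)))
        ≈⟨ +-congʳ core ⟩
      (N * M) ² + (d * σ₁ ² * S₂ ² + d * σ₂ ² * S₁ ²) + (δ + δ) * (α₁ * α₂ - (β + β + (β + β)))
        ≈⟨ +-congʳ (+-congˡ (+-cong (*-congˡ (α² X₂ Y₂)) (*-congˡ (α² X₁ Y₁)))) ⟨
      (N * M) ² + (d * σ₁ ² * (α₂ ² + (a * σ₂ ² + a * σ₂ ²) + (a * σ₂ ² + a * σ₂ ²))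
                 + d * σ₂ ² * (α₁ ² + (a * σ₁ ² + a * σ₁ ²) + (a * σ₁ ² + a * σ₁ ²)))
                + (δ + δ) * (α₁ * α₂ - (β + β + (β + β)))
        ≈⟨ solve 7 (λ W a d σ₁ σ₂ α₁ α₂ →
             let δ = d :* σ₁ :* σ₂; β = a :* σ₁ :* σ₂; b₁ = a :* (σ₁ :* σ₁); b₂ = a :* (σ₂ :* σ₂)
                 UV = σ₁ :* α₂ :+ σ₂ :* α₁ in
             W :+ (d :* (σ₁ :* σ₁) :* (α₂ :* α₂ :+ (b₂ :+ b₂) :+ (b₂ :+ b₂))
                  :+ d :* (σ₂ :* σ₂) :* (α₁ :* α₁ :+ (b₁ :+ b₁) :+ (b₁ :+ b₁)))
               :+ (δ :+ δ) :* (α₁ :* α₂ :- (β :+ β :+ (β :+ β))) :=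
             W :+ d :* (UV :* UV))
             refl ((N * M) ²) a d σ₁ σ₂ α₁ α₂ ⟩
      (N * M) ² + d * (σ₁ * α₂ + σ₂ * α₁) ²
        ≈⟨ +-congˡ (*-congˡ (*-cong UV UV)) ⟨
      (N * M) ² + d * (U * V) ² ∎
      where
      δ = d * σ₁ * σ₂
      β = a * σ₁ * σ₂

  law₂-onCurve : ∀ P Q → OnCurve P → OnCurve Q → OnCurve (law₂ P Q)
  law₂-onCurve ⟨ X₁ ∶ Y₁ ∶ T₁ ∶ Z₁ ⟩ ⟨ X₂ ∶ Y₂ ∶ T₂ ∶ Z₂ ⟩ (c₁ , s₁) (c₂ , s₂) = eq , segre U V N M
    where
    U V N M S₁ S₂ σ₁ σ₂ α₁ α₂ p t : Carrier
    U = T₁ * Z₂ + Z₁ * T₂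
    V = T₁ * Z₂ - Z₁ * T₂
    N = Y₁ * Y₂ + a * X₁ * X₂
    M = X₁ * Y₂ - Y₁ * X₂
    S₁ = a * X₁ ² + Y₁ ²
    S₂ = a * X₂ ² + Y₂ ²
    σ₁ = X₁ * Y₁
    σ₂ = X₂ * Y₂
    α₁ = Y₁ ² - a * X₁ ²
    α₂ = Y₂ ² - a * X₂ ²
    p = T₁ * Z₂
    t = Z₁ * T₂

    expand : a * (U * M) ² + (V * N) ² ≈
             (a * M ² + N ²) * (p ² + t ²) - (p * t + p * t) * (N ² - a * M ²)
    expand = solve 5 (λ a N M p t →
      let U = p :+ t; V = p :- t in
      a :* ((U :* M) :* (U :* M)) :+ (V :* N) :* (V :* N) :=
      (a :* (M :* M) :+ N :* N) :* (p :* p :+ t :* t) :- (p :* t :+ p :* t) :* (N :* N :- a :* (M :* M)))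
      refl a N M p t

    norm : a * M ² + N ² ≈ S₁ * S₂
    norm = solve 5 (λ a X₁ Y₁ X₂ Y₂ →
      let M = X₁ :* Y₂ :- Y₁ :* X₂; N = Y₁ :* Y₂ :+ a :* X₁ :* X₂ in
      a :* (M :* M) :+ N :* N := (a :* (X₁ :* X₁) :+ Y₁ :* Y₁) :* (a :* (X₂ :* X₂) :+ Y₂ :* Y₂))
      refl a X₁ Y₁ X₂ Y₂

    norm⁻ : N ² - a * M ² ≈ α₁ * α₂ + (a * σ₁ * σ₂ + a * σ₁ * σ₂ + (a * σ₁ * σ₂ + a * σ₁ * σ₂))
    norm⁻ = solve 5 (λ a X₁ Y₁ X₂ Y₂ →
      let M = X₁ :* Y₂ :- Y₁ :* X₂; N = Y₁ :* Y₂ :+ a :* X₁ :* X₂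
          s = a :* (X₁ :* Y₁) :* (X₂ :* Y₂) in
      N :* N :- a :* (M :* M) :=
      (Y₁ :* Y₁ :- a :* (X₁ :* X₁)) :* (Y₂ :* Y₂ :- a :* (X₂ :* X₂)) :+ (s :+ s :+ (s :+ s)))
      refl a X₁ Y₁ X₂ Y₂

    pt : p * t ≈ σ₁ * σ₂
    pt = begin
      p * t                            ≈⟨ solve 4 (λ T₁ Z₁ T₂ Z₂ →
                                            (T₁ :* Z₂) :* (Z₁ :* T₂) := (Z₁ :* T₁) :* (Z₂ :* T₂))
                                            refl T₁ Z₁ T₂ Z₂ ⟩
      (Z₁ * T₁) * (Z₂ * T₂)            ≈⟨ *-cong s₁ s₂ ⟨
      σ₁ * σ₂                          ∎

    NM : N * M ≈ σ₁ * α₂ - σ₂ * α₁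
    NM = solve 5 (λ a X₁ Y₁ X₂ Y₂ →
      (Y₁ :* Y₂ :+ a :* X₁ :* X₂) :* (X₁ :* Y₂ :- Y₁ :* X₂) :=
      (X₁ :* Y₁) :* (Y₂ :* Y₂ :- a :* (X₂ :* X₂)) :- (X₂ :* Y₂) :* (Y₁ :* Y₁ :- a :* (X₁ :* X₁)))
      refl a X₁ Y₁ X₂ Y₂

    core : S₁ * S₂ * (p ² + t ²) ≈ d * (U * V) ² + (σ₁ ² * S₂ ² + σ₂ ² * S₁ ²)
    core = begin
      S₁ * S₂ * (p ² + t ²)
        ≈⟨ *-congʳ (*-cong c₁ c₂) ⟩
      (Z₁ ² + d * T₁ ²) * (Z₂ ² + d * T₂ ²) * (p ² + t ²)
        ≈⟨ solve 5 (λ d T₁ Z₁ T₂ Z₂ →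
             let S₁ = Z₁ :* Z₁ :+ d :* (T₁ :* T₁); S₂ = Z₂ :* Z₂ :+ d :* (T₂ :* T₂)
                 p = T₁ :* Z₂; t = Z₁ :* T₂; s₁ = Z₁ :* T₁; s₂ = Z₂ :* T₂
                 UV = (p :+ t) :* (p :- t) in
             S₁ :* S₂ :* (p :* p :+ t :* t) :=
             d :* (UV :* UV) :+ ((s₁ :* s₁) :* (S₂ :* S₂) :+ (s₂ :* s₂) :* (S₁ :* S₁)))
             refl d T₁ Z₁ T₂ Z₂ ⟩
      d * (U * V) ² + ((Z₁ * T₁) ² * (Z₂ ² + d * T₂ ²) ² + (Z₂ * T₂) ² * (Z₁ ² + d * T₁ ²) ²)
        ≈⟨ +-congˡ (+-cong
             (*-cong (*-cong s₁ s₁) (*-cong c₂ c₂))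
             (*-cong (*-cong s₂ s₂) (*-cong c₁ c₁))) ⟨
      d * (U * V) ² + (σ₁ ² * S₂ ² + σ₂ ² * S₁ ²) ∎

    eq : a * (U * M) ² + (V * N) ² ≈ (N * M) ² + d * (U * V) ²
    eq = begin
      a * (U * M) ² + (V * N) ²
        ≈⟨ expand ⟩
      (a * M ² + N ²) * (p ² + t ²) - (p * t + p * t) * (N ² - a * M ²)
        ≈⟨ +-cong (*-congʳ norm) (-‿cong (*-cong (+-cong pt pt) norm⁻)) ⟩
      S₁ * S₂ * (p ² + t ²) - (δ + δ) * (α₁ * α₂ + (β + β + (β + β)))
        ≈⟨ +-congʳ core ⟩
      d * (U * V) ² + (σ₁ ² * S₂ ² + σ₂ ² * S₁ ²) - (δ + δ) * (α₁ * α₂ + (β + β + (β + β)))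
        ≈⟨ +-congʳ (+-congˡ (+-cong (*-congˡ (α² X₂ Y₂)) (*-congˡ (α² X₁ Y₁)))) ⟨
      d * (U * V) ² + (σ₁ ² * (α₂ ² + (a * σ₂ ² + a * σ₂ ²) + (a * σ₂ ² + a * σ₂ ²))
                     + σ₂ ² * (α₁ ² + (a * σ₁ ² + a * σ₁ ²) + (a * σ₁ ² + a * σ₁ ²)))
                    - (δ + δ) * (α₁ * α₂ + (β + β + (β + β)))
        ≈⟨ solve 6 (λ W a σ₁ σ₂ α₁ α₂ →
             let δ = σ₁ :* σ₂; β = a :* σ₁ :* σ₂; b₁ = a :* (σ₁ :* σ₁); b₂ = a :* (σ₂ :* σ₂)
                 NM = σ₁ :* α₂ :- σ₂ :* α₁ in
             W :+ ((σ₁ :* σ₁) :* (α₂ :* α₂ :+ (b₂ :+ b₂) :+ (b₂ :+ b₂))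
                  :+ (σ₂ :* σ₂) :* (α₁ :* α₁ :+ (b₁ :+ b₁) :+ (b₁ :+ b₁)))
               :- (δ :+ δ) :* (α₁ :* α₂ :+ (β :+ β :+ (β :+ β))) :=
             NM :* NM :+ W)
             refl (d * (U * V) ²) a σ₁ σ₂ α₁ α₂ ⟩
      (σ₁ * α₂ - σ₂ * α₁) ² + d * (U * V) ²
        ≈⟨ +-congʳ (*-cong NM NM) ⟨
      (N * M) ² + d * (U * V) ² ∎
      where
      δ = σ₁ * σ₂
      β = a * σ₁ * σ₂

  private
    a≉0 : a ≉ 0#
    a≉0 a≈0 = nonsingular (0* (0* a≈0))

    d≉0 : d ≉ 0#
    d≉0 d≈0 = nonsingular (0* (*0 d≈0))

    a-d≉0 : a - d ≉ 0#
    a-d≉0 a-d≈0 = nonsingular (*0 a-d≈0)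

    difference : ∀ {x y z} → x - y ≈ z → z ≈ 0# → x ≈ y
    difference {x} {y} x-y≈z z≈0 = begin
      x            ≈⟨ solve 2 (λ x y → x := (x :- y) :+ y) refl x y ⟩
      (x - y) + y  ≈⟨ +-congʳ (trans x-y≈z z≈0) ⟩
      0# + y       ≈⟨ +-identityˡ y ⟩
      y            ∎

    colinear : ∀ k u v u′ v′ → u * u′ - k * v * v′ ≈ 0# → v * u′ - u * v′ ≈ 0# →
               ¬ (u′ ≈ 0# × v′ ≈ 0#) → u ² - k * v ² ≈ 0#
    colinear k u v u′ v′ f g ≉0 with u′ ≟ 0# | v′ ≟ 0#
    ... | yes u′≈0 | yes v′≈0 = ⊥-elim (≉0 (u′≈0 , v′≈0))
    ... | no u′≉0  | _ = *-cancel-0 u′≉0 (trans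
      (solve 5 (λ k u v u′ v′ → u′ :* (u :* u :- k :* (v :* v)) :=
        u :* (u :* u′ :- k :* v :* v′) :- k :* v :* (v :* u′ :- u :* v′)) refl k u v u′ v′)
      (0-0 (*0 f) (*0 g)))
    ... | _ | no v′≉0 = *-cancel-0 v′≉0 (trans
      (solve 5 (λ k u v u′ v′ → v′ :* (u :* u :- k :* (v :* v)) :=
        v :* (u :* u′ :- k :* v :* v′) :- u :* (v :* u′ :- u :* v′)) refl k u v u′ v′)
      (0-0 (*0 f) (*0 g)))

    factor : ∀ {U V N M} → IsZero ⟨ U * M ∶ V * N ∶ U * V ∶ N * M ⟩ →
             (U ≈ 0# × N ≈ 0#) ⊎ (V ≈ 0# × M ≈ 0#)
    factor {U} {V} {N} {M} (UM≈0 , VN≈0 , UV≈0 , NM≈0) with U ≟ 0#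
    ... | no U≉0  = inj₂ (*-cancel-0 U≉0 UV≈0 , *-cancel-0 U≉0 UM≈0)
    ... | yes U≈0 with N ≟ 0#
    ...   | yes N≈0 = inj₁ (U≈0 , N≈0)
    ...   | no  N≉0 = inj₂ (*-cancel-0 N≉0 (trans (*-comm N V) VN≈0) , *-cancel-0 N≉0 NM≈0)

    module OnePoint (P : Point) where
      open Point P

      YX≉0 : ¬ (Y ≈ 0# × X ≈ 0#)
      YX≉0 (Y≈0 , X≈0) = nonzero (X≈0 , Y≈0 , TZ≈0)
        where
        S≈0 : Z ² + d * T ² ≈ 0#
        S≈0 = trans (sym (proj₁ onCurve)) (0+0 (*0 (0* X≈0)) (0* Y≈0))
        TZ≈0 : T ≈ 0# × Z ≈ 0#
        TZ≈0 with *-zero-product (trans (sym (proj₂ onCurve)) (0* X≈0))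
        ... | inj₁ Z≈0 = ²-zero (*-cancel-0 d≉0
                (trans (sym (+-identityˡ _)) (trans (+-congʳ (sym (0* Z≈0))) S≈0))) , Z≈0
        ... | inj₂ T≈0 = T≈0 , ²-zero
                (trans (sym (+-identityʳ _)) (trans (+-congˡ (sym (*0 (0* T≈0)))) S≈0))

      ZT≉0 : ¬ (Z ≈ 0# × T ≈ 0#)
      ZT≉0 (Z≈0 , T≈0) = nonzero (proj₁ XY≈0 , proj₂ XY≈0 , T≈0 , Z≈0)
        where
        S≈0 : a * X ² + Y ² ≈ 0#
        S≈0 = trans (proj₁ onCurve) (0+0 (0* Z≈0) (*0 (0* T≈0)))
        XY≈0 : X ≈ 0# × Y ≈ 0#
        XY≈0 with *-zero-product (trans (proj₂ onCurve) (0* Z≈0))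
        ... | inj₁ X≈0 = X≈0 , ²-zero
                (trans (sym (+-identityˡ _)) (trans (+-congʳ (sym (*0 (0* X≈0)))) S≈0))
        ... | inj₂ Y≈0 = ²-zero (*-cancel-0 a≉0
                (trans (sym (+-identityʳ _)) (trans (+-congˡ (sym (0* Y≈0))) S≈0))) , Y≈0

      contradiction₁ : Y ² - a * X ² ≈ 0# → Z ² - d * T ² ≈ 0# → ⊥
      contradiction₁ α≈0 β≈0 = ZT≉0 (Z≈0 , T≈0)
        where
        δ≈0 : a * X ² - d * T ² ≈ 0#
        δ≈0 = double-zero odd (trans
          (solve 6 (λ a d X Y T Z →
            let A = a :* (X :* X); D = d :* (T :* T) in
            (A :- D) :+ (A :- D) :=
            ((A :+ Y :* Y) :- (Z :* Z :+ D)) :- ((Y :* Y :- A) :- (Z :* Z :- D))) refl a d X Y T Z)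
          (0-0 (≈⇒-≈0 (proj₁ onCurve)) (0-0 α≈0 β≈0)))
        T≈0 : T ≈ 0#
        T≈0 = ²-zero (²-zero (*-cancel-0 a-d≉0 (*-cancel-0 d≉0 (trans
          (solve 6 (λ a d X Y T Z →
            let A = a :* (X :* X); D = d :* (T :* T) in
            d :* ((a :- d) :* ((T :* T) :* (T :* T))) :=
            (A :+ D) :* (A :- D) :+ a :* (((X :* X) :* (Y :* Y :- A) :- (T :* T) :* (Z :* Z :- D))
              :- (X :* Y :+ Z :* T) :* (X :* Y :- Z :* T))) refl a d X Y T Z)
          (0+0 (*0 δ≈0) (*0 (0-0 (0-0 (*0 α≈0) (*0 β≈0)) (*0 (≈⇒-≈0 (proj₂ onCurve))))))))))
        Z≈0 : Z ≈ 0#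
        Z≈0 = ²-zero (trans (difference refl β≈0) (*0 (0* T≈0)))

      contradiction₂ : Z ² - - d * T ² ≈ 0# → X ≈ 0# ⊎ Y ≈ 0# → ⊥
      contradiction₂ γ≈0 X≈0⊎Y≈0 = case X≈0⊎Y≈0
        where
        S≈0 : a * X ² + Y ² ≈ 0#
        S≈0 = trans (proj₁ onCurve) (trans
          (solve 3 (λ d T Z → Z :* Z :+ d :* (T :* T) := Z :* Z :- (:- d) :* (T :* T)) refl d T Z) γ≈0)
        case : X ≈ 0# ⊎ Y ≈ 0# → ⊥
        case (inj₁ X≈0) = YX≉0 (²-zero
          (trans (sym (+-identityˡ _)) (trans (+-congʳ (sym (*0 (0* X≈0)))) S≈0)) , X≈0)
        case (inj₂ Y≈0) = YX≉0 (Y≈0 , ²-zero (*-cancel-0 a≉0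
          (trans (sym (+-identityʳ _)) (trans (+-congˡ (sym (0* Y≈0))) S≈0))))

  laws-complete : ∀ (P Q : Point) → IsZero (law₁ (coordinates P) (coordinates Q)) →
                  ¬ IsZero (law₂ (coordinates P) (coordinates Q))
  laws-complete P Q z₁ z₂ = cases (factor z₁) (factor z₂)
    where
    open Point P using () renaming (X to X₁; Y to Y₁; T to T₁; Z to Z₁)
    open Point Q using () renaming (X to X₂; Y to Y₂; T to T₂; Z to Z₂)
    open OnePoint P using (contradiction₁; contradiction₂)
    open OnePoint Q using (YX≉0; ZT≉0)

    U₁ V₁ N₁ M₁ U₂ V₂ N₂ M₂ : Carrier
    U₁ = X₁ * Y₂ + Y₁ * X₂
    V₁ = Y₁ * Y₂ - a * X₁ * X₂
    N₁ = Z₁ * Z₂ + d * T₁ * T₂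
    M₁ = Z₁ * Z₂ - d * T₁ * T₂
    U₂ = T₁ * Z₂ + Z₁ * T₂
    V₂ = T₁ * Z₂ - Z₁ * T₂
    N₂ = Y₁ * Y₂ + a * X₁ * X₂
    M₂ = X₁ * Y₂ - Y₁ * X₂

    minus-minus : ∀ k x y z → z - k * x * - y ≈ z + k * x * y
    minus-minus = solve 4 (λ k x y z → z :- k :* x :* (:- y) := z :+ k :* x :* y) refl

    minus-minus′ : ∀ x y z → z - x * - y ≈ z + x * y
    minus-minus′ = solve 3 (λ x y z → z :- x :* (:- y) := z :+ x :* y) refl

    cases : (U₁ ≈ 0# × N₁ ≈ 0#) ⊎ (V₁ ≈ 0# × M₁ ≈ 0#) →
            (U₂ ≈ 0# × N₂ ≈ 0#) ⊎ (V₂ ≈ 0# × M₂ ≈ 0#) → ⊥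
    cases (inj₁ (U₁≈0 , N₁≈0)) (inj₁ (U₂≈0 , N₂≈0)) = contradiction₁
      (colinear a Y₁ X₁ Y₂ (- X₂) (trans (minus-minus a X₁ X₂ (Y₁ * Y₂)) N₂≈0)
        (trans (minus-minus′ Y₁ X₂ (X₁ * Y₂)) U₁≈0) λ (p , q) → YX≉0 (p , neg-zero q))
      (colinear d Z₁ T₁ Z₂ (- T₂) (trans (minus-minus d T₁ T₂ (Z₁ * Z₂)) N₁≈0)
        (trans (minus-minus′ Z₁ T₂ (T₁ * Z₂)) U₂≈0) λ (p , q) → ZT≉0 (p , neg-zero q))
    cases (inj₂ (V₁≈0 , M₁≈0)) (inj₂ (V₂≈0 , M₂≈0)) = contradiction₁
      (colinear a Y₁ X₁ Y₂ X₂ V₁≈0 M₂≈0 YX≉0)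
      (colinear d Z₁ T₁ Z₂ T₂ M₁≈0 V₂≈0 ZT≉0)
    cases (inj₁ (U₁≈0 , N₁≈0)) (inj₂ (V₂≈0 , M₂≈0)) = contradiction₂
      (colinear (- d) Z₁ T₁ Z₂ T₂
        (trans (solve 4 (λ k x y z → z :- (:- k) :* x :* y := z :+ k :* x :* y) refl d T₁ T₂ (Z₁ * Z₂)) N₁≈0)
        V₂≈0 ZT≉0) X₁≈0⊎Y₁≈0
      where
      X₁Y₂≈0 : X₁ * Y₂ ≈ 0#
      X₁Y₂≈0 = double-zero odd (trans
        (solve 2 (λ x y → x :+ x := (x :+ y) :+ (x :- y)) refl (X₁ * Y₂) (Y₁ * X₂)) (0+0 U₁≈0 M₂≈0))
      Y₁X₂≈0 : Y₁ * X₂ ≈ 0#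
      Y₁X₂≈0 = double-zero odd (trans
        (solve 2 (λ x y → y :+ y := (x :+ y) :- (x :- y)) refl (X₁ * Y₂) (Y₁ * X₂)) (0-0 U₁≈0 M₂≈0))
      X₁≈0⊎Y₁≈0 : X₁ ≈ 0# ⊎ Y₁ ≈ 0#
      X₁≈0⊎Y₁≈0 with *-zero-product X₁Y₂≈0 | *-zero-product Y₁X₂≈0
      ... | inj₁ X₁≈0 | _         = inj₁ X₁≈0
      ... | _         | inj₁ Y₁≈0 = inj₂ Y₁≈0
      ... | inj₂ Y₂≈0 | inj₂ X₂≈0 = ⊥-elim (YX≉0 (Y₂≈0 , X₂≈0))
    cases (inj₂ (V₁≈0 , M₁≈0)) (inj₁ (U₂≈0 , N₂≈0)) = contradiction₂
      (colinear (- d) Z₁ T₁ Z₂ (- T₂)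
        (trans (solve 4 (λ k x y z → z :- (:- k) :* x :* (:- y) := z :- k :* x :* y) refl d T₁ T₂ (Z₁ * Z₂)) M₁≈0)
        (trans (minus-minus′ Z₁ T₂ (T₁ * Z₂)) U₂≈0) λ (p , q) → ZT≉0 (p , neg-zero q)) X₁≈0⊎Y₁≈0
      where
      Y₁Y₂≈0 : Y₁ * Y₂ ≈ 0#
      Y₁Y₂≈0 = double-zero odd (trans
        (solve 2 (λ x y → x :+ x := (x :+ y) :+ (x :- y)) refl (Y₁ * Y₂) (a * X₁ * X₂)) (0+0 N₂≈0 V₁≈0))
      X₁X₂≈0 : X₁ * X₂ ≈ 0#
      X₁X₂≈0 = *-cancel-0 a≉0 (trans (sym (*-assoc a X₁ X₂)) (double-zero odd (trans
        (solve 2 (λ x y → y :+ y := (x :+ y) :- (x :- y)) refl (Y₁ * Y₂) (a * X₁ * X₂)) (0-0 N₂≈0 V₁≈0))))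
      X₁≈0⊎Y₁≈0 : X₁ ≈ 0# ⊎ Y₁ ≈ 0#
      X₁≈0⊎Y₁≈0 with *-zero-product X₁X₂≈0 | *-zero-product Y₁Y₂≈0
      ... | inj₁ X₁≈0 | _         = inj₁ X₁≈0
      ... | _         | inj₁ Y₁≈0 = inj₂ Y₁≈0
      ... | inj₂ X₂≈0 | inj₂ Y₂≈0 = ⊥-elim (YX≉0 (Y₂≈0 , X₂≈0))

  infixl 6 _⊕_ _⊝_
  infix  8 ⊖_

  -- law₁ and law₂ form a complete system of addition laws on the curve
  -- (Bernstein–Lange; Hisil–Wong–Carter–Dawson): laws-complete shows that one
  -- of them applies to any two points, and they agree where both apply.
  _⊕_ : Point → Point → Point
  P ⊕ Q with isZero? (law₁ (coordinates P) (coordinates Q))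
  ... | no ≉0 = record
    { coordinates = law₁ (coordinates P) (coordinates Q)
    ; nonzero     = ≉0
    ; onCurve     = law₁-onCurve _ _ (Point.onCurve P) (Point.onCurve Q)
    }
  ... | yes ≈0 = record
    { coordinates = law₂ (coordinates P) (coordinates Q)
    ; nonzero     = laws-complete P Q ≈0
    ; onCurve     = law₂-onCurve _ _ (Point.onCurve P) (Point.onCurve Q)
    }

  ⊖_ : Point → Point
  ⊖ P = record
    { coordinates = ⟨ - X ∶ Y ∶ - T ∶ Z ⟩
    ; nonzero     = λ (-X≈0 , Y≈0 , -T≈0 , Z≈0) →
        nonzero (neg-zero -X≈0 , Y≈0 , neg-zero -T≈0 , Z≈0)
    ; onCurve     =
        trans (solve 3 (λ a X Y → a :* ((:- X) :* (:- X)) :+ Y :* Y := a :* (X :* X) :+ Y :* Y) refl a X Y)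
          (trans (proj₁ onCurve)
            (solve 3 (λ d T Z → Z :* Z :+ d :* (T :* T) := Z :* Z :+ d :* ((:- T) :* (:- T))) refl d T Z))
      , trans (solve 2 (λ X Y → (:- X) :* Y := :- (X :* Y)) refl X Y)
          (trans (-‿cong (proj₂ onCurve))
            (solve 2 (λ Z T → :- (Z :* T) := Z :* (:- T)) refl Z T))
    }
    where
    open Point P

  _⊝_ : Point → Point → Point
  P ⊝ Q = P ⊕ ⊖ Q

  open Relation.Binary.Construct.Add.Point.Equality _≈_ public using (_≈∙_)

  w : Point → Pointed Carrier
  w P with Point.Z P ≟ 0#
  ... | yes _ = ∞
  ... | no  _ = fin (d * (X / Z) ² * (Y / Z) ²)
    where open Point P

  e : Carrier
  e = 4 ·ℕ a / d

  -- v = W/Z, where the quotient is undefined for W = Z = 0.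
  infix 4 _≐_÷_
  _≐_÷_ : Pointed Carrier → Carrier → Carrier → Set ℓ
  fin v ≐ W ÷ Z = Z ≉ 0# × v ≈ W / Z
  ∞     ≐ W ÷ Z = W ≉ 0# × Z ≈ 0#

------------------------------------------------------------------------

-- Expressions in the inputs w₀, W₁, Z₁, W₂, Z₂ and in k curve constants,
-- which occur only as multipliers.
infixl 6 _⊞_ _⊟_
infixl 7 _⊠_
infixr 8 _⊡_

data Expr (k : ℕ) : Set where
  input       : Fin 5 → Expr k
  _⊞_ _⊟_ _⊠_ : Expr k → Expr k → Expr k
  dbl sqr     : Expr k → Expr k
  _⊡_         : Fin k → Expr k → Expr k

module Evaluation {c ℓ} (F : FiniteField c ℓ) where
  open FiniteField F

  ⟦_⟧ : ∀ {k} → Expr k → Vec Carrier k → Vec Carrier 5 → Carrier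
  ⟦ input i ⟧ κ ρ = lookup ρ i
  ⟦ s ⊞ t   ⟧ κ ρ = ⟦ s ⟧ κ ρ + ⟦ t ⟧ κ ρ
  ⟦ s ⊟ t   ⟧ κ ρ = ⟦ s ⟧ κ ρ - ⟦ t ⟧ κ ρ
  ⟦ s ⊠ t   ⟧ κ ρ = ⟦ s ⟧ κ ρ * ⟦ t ⟧ κ ρ
  ⟦ dbl t   ⟧ κ ρ = ⟦ t ⟧ κ ρ + ⟦ t ⟧ κ ρ
  ⟦ sqr t   ⟧ κ ρ = ⟦ t ⟧ κ ρ ²
  ⟦ i ⊡ t   ⟧ κ ρ = lookup κ i * ⟦ t ⟧ κ ρ

_==_ : ∀ {k} → Expr k → Expr k → Bool
input i == input j   = does (i Fin.≟ j)
(s ⊞ t) == (s′ ⊞ t′) = (s == s′) ∧ (t == t′)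
(s ⊟ t) == (s′ ⊟ t′) = (s == s′) ∧ (t == t′)
(s ⊠ t) == (s′ ⊠ t′) = (s == s′) ∧ (t == t′)
dbl t   == dbl t′    = t == t′
sqr t   == sqr t′    = t == t′
(i ⊡ t) == (j ⊡ t′)  = does (i Fin.≟ j) ∧ (t == t′)
_       == _         = false

subexpressions : ∀ {k} → Expr k → List (Expr k)
subexpressions u@(input _) = u ∷ []
subexpressions u@(s ⊞ t)   = u ∷ subexpressions s ++ subexpressions t
subexpressions u@(s ⊟ t)   = u ∷ subexpressions s ++ subexpressions t
subexpressions u@(s ⊠ t)   = u ∷ subexpressions s ++ subexpressions t
subexpressions u@(dbl t)   = u ∷ subexpressions t
subexpressions u@(sqr t)   = u ∷ subexpressions t
subexpressions u@(_ ⊡ t)   = u ∷ subexpressions t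

record Cost : Set where
  constructor _𝐌+_𝐒+_𝐃
  field multiplications squarings constantMultiplications : ℕ

-- Each distinct subexpression is computed once, and additions, subtractions
-- and doublings are free.
cost : ∀ {k} → List (Expr k) → Cost
cost ts = tally (deduplicateᵇ _==_ (concatMap subexpressions ts))
  where
  tally : List (Expr _) → Cost
  tally []             = 0 𝐌+ 0 𝐒+ 0 𝐃
  tally ((_ ⊠ _) ∷ us) = let m 𝐌+ s 𝐒+ n 𝐃 = tally us in ℕ.suc m 𝐌+ s 𝐒+ n 𝐃
  tally (sqr _   ∷ us) = let m 𝐌+ s 𝐒+ n 𝐃 = tally us in m 𝐌+ ℕ.suc s 𝐒+ n 𝐃
  tally ((_ ⊡ _) ∷ us) = let m 𝐌+ s 𝐒+ n 𝐃 = tally us in m 𝐌+ s 𝐒+ ℕ.suc n 𝐃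
  tally (_       ∷ us) = tally us

------------------------------------------------------------------------

module DifferentialAddition {k : ℕ} where
  w₀ W₁ Z₁ W₂ Z₂ A₁ B₁ A₂ B₂ C D W₃ Z₃ : Expr k
  w₀ = input zero
  W₁ = input (suc zero)
  Z₁ = input (suc (suc zero))
  W₂ = input (suc (suc (suc zero)))
  Z₂ = input (suc (suc (suc (suc zero))))
  A₁ = W₁ ⊞ Z₁
  B₁ = W₁ ⊟ Z₁
  A₂ = W₂ ⊞ Z₂
  B₂ = W₂ ⊟ Z₂
  C  = A₁ ⊠ B₂
  D  = A₂ ⊠ B₁
  W₃ = sqr (C ⊟ D)
  Z₃ = w₀ ⊠ sqr (C ⊞ D)

module Doubling-i where
  open DifferentialAddition {1} using (A₁; B₁)
  e/4 : Fin 1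
  e/4 = zero
  E W₄ Z₄ : Expr 1
  E  = sqr A₁ ⊟ sqr B₁
  W₄ = E ⊠ (sqr A₁ ⊟ e/4 ⊡ E)
  Z₄ = sqr A₁ ⊠ sqr B₁

module Doubling-ii where
  open DifferentialAddition {1} using (A₁; B₁)
  e/4 : Fin 1
  e/4 = zero
  E F W₄ Z₄ : Expr 1
  E  = sqr A₁ ⊟ sqr B₁
  F  = (sqr (sqr A₁) ⊞ sqr (sqr B₁)) ⊟ sqr E
  W₄ = dbl (sqr (sqr A₁) ⊟ e/4 ⊡ sqr E) ⊟ F
  Z₄ = F

module Doubling-iii where
  open DifferentialAddition {2} using (A₁; B₁)
  r 1/r : Fin 2
  r   = zero
  1/r = suc zero
  H₁ H₂ G K S T W₄ Z₄ : Expr 2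
  H₁ = sqr (r ⊡ sqr A₁ ⊞ sqr B₁)
  H₂ = sqr (r ⊡ sqr A₁ ⊟ sqr B₁)
  G  = H₁ ⊞ H₂
  K  = H₁ ⊟ H₂
  S  = 1/r ⊡ K
  T  = r ⊡ K
  W₄ = dbl G ⊟ S ⊟ T
  Z₄ = T ⊟ S

{-# OPTIONS --safe #-}

-- Write w(P) as the point (d T² : Z²) of ℙ¹, which also covers the points at
-- infinity, and let (Wᵢ , Zᵢ) = λᵢ (d Tᵢ² , Zᵢ²).  With p, n and m the T- and
-- Z-coordinates of P₁ + P₂ and the T-coordinate of P₂ − P₁ under the first
-- addition law, and l = T₂²Z₁² − T₁²Z₂², the curve equations give p m = l n.
-- Under the first law P₂ − P₁ has (T : Z) = (m : n), under the second (l : p);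
-- hence w₀ p² = d l² in both cases, and the first law applies to P₁ + P₂ in
-- both.  Since (W₃ , Z₃) = 4 λ₁²λ₂² (d² l² , w₀ n²), this is the claim for
-- P₁ + P₂.  The first law applies to P + P, since the second one vanishes there
-- and the two never vanish together; in case (i) (W₄ , Z₄) is then λ⁴ (d T² , Z²),
-- and (ii), (iii) rescale (i) by 2 and by 4(r² − 1).
module Submission where

open import Defs
open import Data.Bool.Base using (if_then_else_)
open import Data.Empty using (⊥-elim)
open import Data.Integer.Base using (0ℤ; 1ℤ; -1ℤ)
open import Data.List.Base using (List; []; _∷_)
open import Data.Product using (_×_; _,_; proj₁; proj₂)
open import Data.Sum using (_⊎_; inj₁; inj₂)
open import Data.Vec.Base using (Vec; []; _∷_)
open import Function.Bundles using (_⇔_; mk⇔; Equivalence)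
import Level
import Relation.Binary.Construct.Add.Point.Equality as PointedEquality
open import Relation.Binary.PropositionalEquality as ≡ using (_≡_)
open import Relation.Nullary using (¬_; Dec; yes; no; does)
open import Relation.Nullary.Construct.Add.Point using () renaming (∙ to ∞; [_] to fin)

-- Division, multiples of four and nonzero squares in a finite field.

module FiniteFieldProperties {c ℓ} (F : FiniteField c ℓ) where
  open FiniteField F
  open FieldProperties F
  open RingSolver commutativeRing
  open import Relation.Binary.Reasoning.Setoid setoid

  *-inverseʳ : ∀ {x} → x ≉ 0# → x * x ⁻¹ ≈ 1#
  *-inverseʳ {x} x≉0 with x ≟ 0#
  ... | yes x≈0 = ⊥-elim (x≉0 x≈0)
  ... | no  x≉0 = proj₂ (proj₂ (nonzero⇒invertible x x≉0))

  *-≉0 : ∀ {x y} → x ≉ 0# → y ≉ 0# → x * y ≉ 0#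
  *-≉0 x≉0 y≉0 xy≈0 = y≉0 (*-cancel-0 x≉0 xy≈0)

  ²-≉0 : ∀ {x} → x ≉ 0# → x ² ≉ 0#
  ²-≉0 x≉0 = *-≉0 x≉0 x≉0

  ⁻¹-≉0 : ∀ {x} → x ≉ 0# → x ⁻¹ ≉ 0#
  ⁻¹-≉0 x≉0 x⁻¹≈0 = 0≉1 (trans (sym (*0 x⁻¹≈0)) (*-inverseʳ x≉0))

  /-*-cancel : ∀ {x y} → y ≉ 0# → x / y * y ≈ x
  /-*-cancel {x} {y} y≉0 = begin
    x * y ⁻¹ * y    ≈⟨ solve 3 (λ x y i → x :* i :* y := x :* (y :* i)) refl x y (y ⁻¹) ⟩
    x * (y * y ⁻¹)  ≈⟨ *-congˡ (*-inverseʳ y≉0) ⟩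
    x * 1#          ≈⟨ *-identityʳ x ⟩
    x               ∎

  *-cancelˡ : ∀ {x y z} → x ≉ 0# → x * y ≈ x * z → y ≈ z
  *-cancelˡ {x} {y} {z} x≉0 xy≈xz = begin
    y                ≈⟨ cancel y ⟨
    x ⁻¹ * (x * y)   ≈⟨ *-congˡ xy≈xz ⟩
    x ⁻¹ * (x * z)   ≈⟨ cancel z ⟩
    z                ∎
    where
    cancel : ∀ u → x ⁻¹ * (x * u) ≈ u
    cancel u = begin
      x ⁻¹ * (x * u)  ≈⟨ solve 3 (λ i x u → i :* (x :* u) := (x :* i) :* u) refl (x ⁻¹) x u ⟩
      x * x ⁻¹ * u    ≈⟨ *-congʳ (*-inverseʳ x≉0) ⟩
      1# * u          ≈⟨ *-identityˡ u ⟩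
      u               ∎

  ²-cong : ∀ {x y} → x ≈ y → x ² ≈ y ²
  ²-cong x≈y = *-cong x≈y x≈y

  x+x≈2*x : ∀ x → x + x ≈ (1# + 1#) * x
  x+x≈2*x x = sym (trans (distribʳ x 1# 1#) (+-cong (*-identityˡ x) (*-identityˡ x)))

  4·≈ : ∀ x → 4 ·ℕ x ≈ (x + x) + (x + x)
  4·≈ x = trans (+-congˡ (+-congˡ (+-congˡ (+-identityʳ x)))) (sym (+-assoc x x (x + x)))

  double-≉0 : OddCharacteristic → ∀ {x} → x ≉ 0# → x + x ≉ 0#
  double-≉0 odd x≉0 x+x≈0 = x≉0 (double-zero odd x+x≈0)

  4≉0 : OddCharacteristic → 4 ·ℕ 1# ≉ 0#
  4≉0 odd 4≈0 = double-≉0 odd (double-≉0 odd λ 1≈0 → 0≉1 (sym 1≈0)) (trans (sym (4·≈ 1#)) 4≈0)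

  4·≈4* : ∀ x → 4 ·ℕ x ≈ (4 ·ℕ 1#) * x
  4·≈4* x = begin
    4 ·ℕ x                               ≈⟨ 4·≈ x ⟩
    (x + x) + (x + x)                    ≈⟨ +-cong (x+x≈2*x x) (x+x≈2*x x) ⟩
    (1# + 1#) * x + (1# + 1#) * x        ≈⟨ distribʳ x (1# + 1#) (1# + 1#) ⟨
    ((1# + 1#) + (1# + 1#)) * x          ≈⟨ *-congʳ (4·≈ 1#) ⟨
    (4 ·ℕ 1#) * x                        ∎

  IsNonzeroSquare-scale : ∀ {k x y} → k ≉ 0# → y ≈ k ² * x → IsNonzeroSquare x → IsNonzeroSquare y
  IsNonzeroSquare-scale {k} {x} {y} k≉0 y≈k²x (x≉0 , t , t²≈x) =
    (λ y≈0 → *-≉0 (²-≉0 k≉0) x≉0 (trans (sym y≈k²x) y≈0)) , k * t , (begin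
      (k * t) ²   ≈⟨ solve 2 (λ k t → (k :* t) :* (k :* t) := (k :* k) :* (t :* t)) refl k t ⟩
      k ² * t ²   ≈⟨ *-congˡ t²≈x ⟩
      k ² * x     ≈⟨ y≈k²x ⟨
      y           ∎)

  χ≡1 : ∀ x → IsNonzeroSquare x ⇔ χ x ≡ 1ℤ
  χ≡1 x = χ≡1′ (x ≟ 0#) (isSquare? x)
    where
    -- With both decisions as arguments, matching on them reduces the conditionals inside `χ`.
    χ≡1′ : ∀ {p p′} {P : Set p} {P′ : Set p′} (P? : Dec P) (P′? : Dec P′) →
           (¬ P × P′) ⇔ (if does P? then 0ℤ else if does P′? then 1ℤ else -1ℤ) ≡ 1ℤ
    χ≡1′ (yes p) _        = mk⇔ (λ (¬p , _) → ⊥-elim (¬p p)) λ ()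
    χ≡1′ (no ¬p) (yes p′) = mk⇔ (λ _ → ≡.refl) λ _ → ¬p , p′
    χ≡1′ (no _)  (no ¬p′) = mk⇔ (λ (_ , p′) → ⊥-elim (¬p′ p′)) λ ()

module TwistedEdwardsProperties {c ℓ} (F : FiniteField c ℓ) (odd : FiniteField.OddCharacteristic F)
  (a d : FiniteField.Carrier F) (nonsingular : Nonsingular F a d) where

  open FiniteField F
  open FieldProperties F
  open FiniteFieldProperties F
  open RingSolver commutativeRing
  open TwistedEdwards F odd a d nonsingular
  open Point using (coordinates)
  open import Relation.Binary.Reasoning.Setoid setoid

  -- The curve constant e and the square criterion.

  four : Carrier
  four = 4 ·ℕ 1#

  d≉0 : d ≉ 0#
  d≉0 d≈0 = nonsingular (0* (*0 d≈0))

  four≉0 : four ≉ 0#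
  four≉0 = 4≉0 odd

  -- Follows from e = 4a/d; it turns the multiplier e/4 of the doubling formulas into the a of the
  -- curve equation.
  e/4*d≈a : e / four * d ≈ a
  e/4*d≈a = *-cancelˡ four≉0 (begin
    four * (e / four * d)  ≈⟨ solve 3 (λ f q d → f :* (q :* d) := (q :* f) :* d) refl four (e / four) d ⟩
    e / four * four * d    ≈⟨ *-congʳ (/-*-cancel four≉0) ⟩
    e * d                  ≈⟨ /-*-cancel d≉0 ⟩
    4 ·ℕ a                 ≈⟨ 4·≈4* a ⟩
    four * a               ∎)

  -- With k = 4/d, both e = k a and 4 = k d.
  e*[e-4] : e * (e - four) ≈ (four / d) ² * (a * (a - d))
  e*[e-4] = begin
    e * (e - four)                                     ≈⟨ *-cong e≈ (+-cong e≈ (-‿cong (sym (/-*-cancel d≉0)))) ⟩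
    four / d * a * (four / d * a - four / d * d)       ≈⟨ solve 3 (λ k a d → k :* a :* (k :* a :- k :* d) := (k :* k) :* (a :* (a :- d))) refl (four / d) a d ⟩
    (four / d) ² * (a * (a - d))                       ∎
    where
    e≈ : e ≈ four / d * a
    e≈ = trans (*-congʳ (4·≈4* a))
      (solve 3 (λ f a i → f :* a :* i := f :* i :* a) refl four a (d ⁻¹))

  -- The two elements differ by the nonzero square factor (4/d)², so each is a nonzero square when
  -- the other is; `χ≡1` does the rest.
  square-criterion : IsNonzeroSquare (e * (e - four)) ⇔ χ (a * (a - d)) ≡ 1ℤ
  square-criterion = mk⇔
    (λ sq → to (IsNonzeroSquare-scale (⁻¹-≉0 k≉0) back sq))
    (λ χ≡ → IsNonzeroSquare-scale k≉0 e*[e-4] (from χ≡))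
    where
    open Equivalence (χ≡1 (a * (a - d))) using (to; from)
    k : Carrier
    k = four / d
    k≉0 : k ≉ 0#
    k≉0 = *-≉0 four≉0 (⁻¹-≉0 d≉0)
    back : a * (a - d) ≈ (k ⁻¹) ² * (e * (e - four))
    back = *-cancelˡ (²-≉0 k≉0) (begin
      k ² * (a * (a - d))                       ≈⟨ e*[e-4] ⟨
      e * (e - four)                            ≈⟨ *-identityˡ _ ⟨
      1# * (e * (e - four))                     ≈⟨ *-congʳ (trans (²-cong (*-inverseʳ k≉0)) (*-identityˡ 1#)) ⟨
      (k * k ⁻¹) ² * (e * (e - four))           ≈⟨ solve 3 (λ k i x → ((k :* i) :* (k :* i)) :* x := (k :* k) :* ((i :* i) :* x)) refl k (k ⁻¹) (e * (e - four)) ⟩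
      k ² * ((k ⁻¹) ² * (e * (e - four)))       ∎)

  -- The addition laws on the diagonal.

  -- The antisymmetric factors T₁Z₂ - Z₁T₂ and X₁Y₂ - Y₁X₂ vanish, and every coordinate contains one
  -- of them.
  law₂-self-zero : ∀ V → IsZero (law₂ V V)
  law₂-self-zero ⟨ X ∶ Y ∶ T ∶ Z ⟩ = *0 M≈0 , 0* V≈0 , *0 V≈0 , *0 M≈0
    where
    M≈0 : X * Y - Y * X ≈ 0#
    M≈0 = ≈⇒-≈0 (*-comm X Y)
    V≈0 : T * Z - Z * T ≈ 0#
    V≈0 = ≈⇒-≈0 (*-comm T Z)

  -- By completeness of the two laws; hence every doubling is computed by `law₁`.
  law₁-self-nonzero : ∀ P → ¬ IsZero (law₁ (coordinates P) (coordinates P))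
  law₁-self-nonzero P z = laws-complete P P z (law₂-self-zero (coordinates P))

  -- Such a point would make law₁ P P vanish.
  ZT≉0 : ∀ P → Point.Z P ≈ 0# → Point.T P ≉ 0#
  ZT≉0 P Z≈0 T≈0 = law₁-self-nonzero P (*0 M≈0 , *0 N≈0 , 0* U≈0 , *0 M≈0)
    where
    open Point P
    XY≈0 : X * Y ≈ 0#
    XY≈0 = trans (proj₂ onCurve) (0* Z≈0)
    U≈0 : X * Y + Y * X ≈ 0#
    U≈0 = 0+0 XY≈0 (trans (*-comm Y X) XY≈0)
    N≈0 : Z * Z + d * T * T ≈ 0#
    N≈0 = 0+0 (0* Z≈0) (*0 T≈0)
    M≈0 : Z * Z - d * T * T ≈ 0#
    M≈0 = 0-0 (0* Z≈0) (*0 T≈0)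

  -- The w-coordinate as a point of the projective line.

  -- With x = X/Z and y = Y/Z one has (xZ)(yZ) = XY = ZT; the factor Z² inserted to use this is
  -- cancelled.
  affine-w : ∀ P → Point.Z P ≉ 0# → let open Point P in
             d * (X / Z) ² * (Y / Z) ² * Z ² ≈ d * T ²
  affine-w P Z≉0 = *-cancelˡ (²-≉0 Z≉0) (begin
    Z ² * (d * (X / Z) ² * (Y / Z) ² * Z ²)
      ≈⟨ solve 4 (λ d x y Z → (Z :* Z) :* (d :* (x :* x) :* (y :* y) :* (Z :* Z)) :=
           d :* (((x :* Z) :* (y :* Z)) :* ((x :* Z) :* (y :* Z)))) refl d (X / Z) (Y / Z) Z ⟩
    d * ((X / Z * Z) * (Y / Z * Z)) ²
      ≈⟨ *-congˡ (²-cong (trans (*-cong (/-*-cancel Z≉0) (/-*-cancel Z≉0)) (proj₂ onCurve))) ⟩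
    d * (Z * T) ²
      ≈⟨ solve 3 (λ d Z T → d :* ((Z :* T) :* (Z :* T)) := (Z :* Z) :* (d :* (T :* T))) refl d Z T ⟩
    Z ² * (d * T ²) ∎)
    where open Point P

  -- Says (W : Z′) = (d T² : Z²) on the projective line, with an explicit scalar, so that polynomial
  -- identities prove it without separating affine points from infinity. It speaks of bare
  -- coordinates in order to apply to the value of an addition law.
  record _∝_,_ (V : Coordinates) (W Z′ : Carrier) : Set (c Level.⊔ ℓ) where
    constructor scaled
    open Coordinates V
    field
      factor   : Carrier
      factor≉0 : factor ≉ 0#
      W≈       : W ≈ factor * (d * T ²)
      Z≈       : Z′ ≈ factor * Z ²

  ∝-rescale : ∀ {V W Z k W′ Z′} → k ≉ 0# → W′ ≈ k * W → Z′ ≈ k * Z → V ∝ W , Z → V ∝ W′ , Z′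
  ∝-rescale {k = k} k≉0 W′≈ Z′≈ (scaled μ μ≉0 W≈ Z≈) = scaled (k * μ) (*-≉0 k≉0 μ≉0)
    (trans W′≈ (trans (*-congˡ W≈) (sym (*-assoc k μ _))))
    (trans Z′≈ (trans (*-congˡ Z≈) (sym (*-assoc k μ _))))

  -- The scalar comes from the coordinate that cannot vanish: d T² at infinity, Z² on affine points.
  ≐⇒∝ : ∀ P {W Z} → w P ≐ W ÷ Z → coordinates P ∝ W , Z
  ≐⇒∝ P {W} {Z′} w≐ with Point.Z P ≟ 0#
  ≐⇒∝ P {W} {Z′} (W≉0 , Z′≈0) | yes Z≈0 = scaled (W / (d * T ²)) (*-≉0 W≉0 (⁻¹-≉0 dT²≉0))
    (sym (/-*-cancel dT²≉0)) (trans Z′≈0 (sym (*0 (0* Z≈0))))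
    where
    open Point P
    dT²≉0 : d * T ² ≉ 0#
    dT²≉0 = *-≉0 d≉0 (²-≉0 (ZT≉0 P Z≈0))
  ≐⇒∝ P {W} {Z′} (Z′≉0 , v≈) | no Z≉0 = scaled (Z′ / Z ²) (*-≉0 Z′≉0 (⁻¹-≉0 (²-≉0 Z≉0)))
    (sym (begin
      Z′ / Z ² * (d * T ²)    ≈⟨ *-congˡ (affine-w P Z≉0) ⟨
      Z′ / Z ² * (v * Z ²)    ≈⟨ solve 3 (λ x v z → x :* (v :* z) := v :* (x :* z)) refl (Z′ / Z ²) v (Z ²) ⟩
      v * (Z′ / Z ² * Z ²)    ≈⟨ *-cong v≈ (/-*-cancel (²-≉0 Z≉0)) ⟩
      W / Z′ * Z′             ≈⟨ /-*-cancel Z′≉0 ⟩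
      W                       ∎))
    (sym (/-*-cancel (²-≉0 Z≉0)))
    where
    open Point P
    v : Carrier
    v = d * (X / Z) ² * (Y / Z) ²

  ∝⇒≐ : ∀ P {W Z} → coordinates P ∝ W , Z → w P ≐ W ÷ Z
  ∝⇒≐ P {W} {Z′} (scaled μ μ≉0 W≈ Z′≈) with Point.Z P ≟ 0#
  ... | yes Z≈0 = (λ W≈0 → *-≉0 μ≉0 (*-≉0 d≉0 (²-≉0 (ZT≉0 P Z≈0))) (trans (sym W≈) W≈0))
                , trans Z′≈ (*0 (0* Z≈0))
  ... | no  Z≉0 = Z′≉0 , *-cancelˡ Z′≉0 (begin
    Z′ * v             ≈⟨ *-congʳ Z′≈ ⟩
    μ * Z ² * v        ≈⟨ solve 3 (λ μ z v → μ :* z :* v := μ :* (v :* z)) refl μ (Z ²) v ⟩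
    μ * (v * Z ²)      ≈⟨ *-congˡ (affine-w P Z≉0) ⟩
    μ * (d * T ²)      ≈⟨ W≈ ⟨
    W                  ≈⟨ /-*-cancel Z′≉0 ⟨
    W / Z′ * Z′        ≈⟨ *-comm _ Z′ ⟩
    Z′ * (W / Z′)      ∎)
    where
    open Point P
    v : Carrier
    v = d * (X / Z) ² * (Y / Z) ²
    Z′≉0 : Z′ ≉ 0#
    Z′≉0 Z′≈0 = *-≉0 μ≉0 (²-≉0 Z≉0) (trans (sym Z′≈) Z′≈0)

  ≐⇒nonzero : ∀ v {W Z} → v ≐ W ÷ Z → ¬ (W ≈ 0# × Z ≈ 0#)
  ≐⇒nonzero (fin _) (Z≉0 , _) (_ , Z≈0) = Z≉0 Z≈0
  ≐⇒nonzero ∞       (W≉0 , _) (W≈0 , _) = W≉0 W≈0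

  -- A finite value rules out the points at infinity; through this the hypothesis on P₂ - P₁ enters.
  finite-w : ∀ P {v} → w P ≈∙ fin v → let open Point P in Z ≉ 0# × v * Z ² ≈ d * T ²
  finite-w P eq with Point.Z P ≟ 0#
  finite-w P ()                      | yes _
  finite-w P PointedEquality.[ v≈ ]  | no Z≉0 = Z≉0 , trans (*-congʳ (sym v≈)) (affine-w P Z≉0)

  -- The law that computes a sum.

  ⊕-cases : ∀ P Q → coordinates (P ⊕ Q) ≡ law₁ (coordinates P) (coordinates Q)
                  ⊎ coordinates (P ⊕ Q) ≡ law₂ (coordinates P) (coordinates Q)
  ⊕-cases P Q with isZero? (law₁ (coordinates P) (coordinates Q))
  ... | no  _ = inj₁ ≡.refl
  ... | yes _ = inj₂ ≡.refl

  ⊕-law₁ : ∀ P Q → ¬ IsZero (law₁ (coordinates P) (coordinates Q)) →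
           coordinates (P ⊕ Q) ≡ law₁ (coordinates P) (coordinates Q)
  ⊕-law₁ P Q ≉0 with isZero? (law₁ (coordinates P) (coordinates Q))
  ... | no  _  = ≡.refl
  ... | yes ≈0 = ⊥-elim (≉0 ≈0)

  -- The sum P₁ + P₂ from a known difference.

  module Addition (P₁ P₂ : Point) where
    open Point P₁ using () renaming (X to X₁; Y to Y₁; T to T₁; Z to Z₁; onCurve to onCurve₁)
    open Point P₂ using () renaming (X to X₂; Y to Y₂; T to T₂; Z to Z₂; onCurve to onCurve₂)

    -- `m` keeps the minus signs, so that it is literally the T-coordinate of `law₁` at `P₂` and
    -- `⊖ P₁`.
    p n m l : Carrier
    p = (X₁ * Y₂ + Y₁ * X₂) * (Y₁ * Y₂ - a * X₁ * X₂)
    n = (Z₁ * Z₂ + d * T₁ * T₂) * (Z₁ * Z₂ - d * T₁ * T₂)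
    m = (X₂ * Y₁ + Y₂ * - X₁) * (Y₂ * Y₁ - a * X₂ * - X₁)
    l = T₂ ² * Z₁ ² - T₁ ² * Z₂ ²

    -- Put σᵢ = XᵢYᵢ = ZᵢTᵢ and Sᵢ = aXᵢ² + Yᵢ² = Zᵢ² + dTᵢ². Both products equal σ₂²S₁² - σ₁²S₂²,
    -- the left one in X and Y, the right one in Z and T.
    pm≈ln : p * m ≈ l * n
    pm≈ln = begin
      p * m
        ≈⟨ solve 5 (λ a X₁ Y₁ X₂ Y₂ →
             let σ₁ = X₁ :* Y₁; σ₂ = X₂ :* Y₂
                 S₁ = a :* (X₁ :* X₁) :+ Y₁ :* Y₁; S₂ = a :* (X₂ :* X₂) :+ Y₂ :* Y₂ in
             ((X₁ :* Y₂ :+ Y₁ :* X₂) :* (Y₁ :* Y₂ :- a :* X₁ :* X₂)) :*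
             ((X₂ :* Y₁ :+ Y₂ :* (:- X₁)) :* (Y₂ :* Y₁ :- a :* X₂ :* (:- X₁))) :=
             (σ₂ :* σ₂) :* (S₁ :* S₁) :- (σ₁ :* σ₁) :* (S₂ :* S₂)) refl a X₁ Y₁ X₂ Y₂ ⟩
      (X₂ * Y₂) ² * (a * X₁ ² + Y₁ ²) ² - (X₁ * Y₁) ² * (a * X₂ ² + Y₂ ²) ²
        ≈⟨ +-cong (*-cong (²-cong (proj₂ onCurve₂)) (²-cong (proj₁ onCurve₁)))
             (-‿cong (*-cong (²-cong (proj₂ onCurve₁)) (²-cong (proj₁ onCurve₂)))) ⟩
      (Z₂ * T₂) ² * (Z₁ ² + d * T₁ ²) ² - (Z₁ * T₁) ² * (Z₂ ² + d * T₂ ²) ²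
        ≈⟨ solve 5 (λ d T₁ Z₁ T₂ Z₂ →
             let s₁ = Z₁ :* T₁; s₂ = Z₂ :* T₂
                 S₁ = Z₁ :* Z₁ :+ d :* (T₁ :* T₁); S₂ = Z₂ :* Z₂ :+ d :* (T₂ :* T₂) in
             (s₂ :* s₂) :* (S₁ :* S₁) :- (s₁ :* s₁) :* (S₂ :* S₂) :=
             ((T₂ :* T₂) :* (Z₁ :* Z₁) :- (T₁ :* T₁) :* (Z₂ :* Z₂)) :*
             ((Z₁ :* Z₂ :+ d :* T₁ :* T₂) :* (Z₁ :* Z₂ :- d :* T₁ :* T₂))) refl d T₁ Z₁ T₂ Z₂ ⟩
      l * n ∎

    -- Negating T₁ swaps the two factors.
    difference-law₁ : (Z₂ * Z₁ + d * T₂ * - T₁) * (Z₂ * Z₁ - d * T₂ * - T₁) ≈ n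
    difference-law₁ = solve 5 (λ d T₁ Z₁ T₂ Z₂ →
      (Z₂ :* Z₁ :+ d :* T₂ :* (:- T₁)) :* (Z₂ :* Z₁ :- d :* T₂ :* (:- T₁)) :=
      (Z₁ :* Z₂ :+ d :* T₁ :* T₂) :* (Z₁ :* Z₂ :- d :* T₁ :* T₂)) refl d T₁ Z₁ T₂ Z₂

    difference-law₂-T : (T₂ * Z₁ + Z₂ * - T₁) * (T₂ * Z₁ - Z₂ * - T₁) ≈ l
    difference-law₂-T = solve 4 (λ T₁ Z₁ T₂ Z₂ →
      (T₂ :* Z₁ :+ Z₂ :* (:- T₁)) :* (T₂ :* Z₁ :- Z₂ :* (:- T₁)) :=
      (T₂ :* T₂) :* (Z₁ :* Z₁) :- (T₁ :* T₁) :* (Z₂ :* Z₂)) refl T₁ Z₁ T₂ Z₂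

    -- Negating X₁ turns the factors N and M of `law₂` into the factors V and U of `law₁`.
    difference-law₂-Z : (Y₂ * Y₁ + a * X₂ * - X₁) * (X₂ * Y₁ - Y₂ * - X₁) ≈ p
    difference-law₂-Z = solve 5 (λ a X₁ Y₁ X₂ Y₂ →
      (Y₂ :* Y₁ :+ a :* X₂ :* (:- X₁)) :* (X₂ :* Y₁ :- Y₂ :* (:- X₁)) :=
      (X₁ :* Y₂ :+ Y₁ :* X₂) :* (Y₁ :* Y₂ :- a :* X₁ :* X₂)) refl a X₁ Y₁ X₂ Y₂

    -- Trades p², which involves X and Y, for l², which like n is a polynomial in the Tᵢ² and Zᵢ².
    w₀p²≈dl² : ∀ {w₀} → w (P₂ ⊝ P₁) ≈∙ fin w₀ →
               ¬ IsZero (law₁ (coordinates P₁) (coordinates P₂)) × w₀ * p ² ≈ d * l ²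
    w₀p²≈dl² {w₀} eq = cases (finite-w (P₂ ⊝ P₁) eq) (⊕-cases P₂ (⊖ P₁))
      where
      Finite : Coordinates → Set ℓ
      Finite ⟨ X ∶ Y ∶ T ∶ Z ⟩ = Z ≉ 0# × w₀ * Z ² ≈ d * T ²

      -- `V` is general so that matching on `≡.refl` substitutes the law in use.
      cases : ∀ {V} → Finite V →
              V ≡ law₁ (coordinates P₂) (coordinates (⊖ P₁)) ⊎
              V ≡ law₂ (coordinates P₂) (coordinates (⊖ P₁)) →
              ¬ IsZero (law₁ (coordinates P₁) (coordinates P₂)) × w₀ * p ² ≈ d * l ²
      -- Here w₀ n² = d m² with n ≠ 0: multiply by p², replace p m by l n and cancel n².
      cases (n′≉0 , w₀n′²≈) (inj₁ ≡.refl) =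
        (λ (_ , _ , _ , n≈0) → n≉0 n≈0) , *-cancelˡ (²-≉0 n≉0) (begin
          n ² * (w₀ * p ²)    ≈⟨ solve 3 (λ n w p → (n :* n) :* (w :* (p :* p)) := (p :* p) :* (w :* (n :* n))) refl n w₀ p ⟩
          p ² * (w₀ * n ²)    ≈⟨ *-congˡ (*-congˡ (²-cong difference-law₁)) ⟨
          p ² * (w₀ * _ ²)    ≈⟨ *-congˡ w₀n′²≈ ⟩
          p ² * (d * m ²)     ≈⟨ solve 3 (λ p d m → (p :* p) :* (d :* (m :* m)) := d :* ((p :* m) :* (p :* m))) refl p d m ⟩
          d * (p * m) ²       ≈⟨ *-congˡ (²-cong pm≈ln) ⟩
          d * (l * n) ²       ≈⟨ solve 3 (λ n d l → d :* ((l :* n) :* (l :* n)) := (n :* n) :* (d :* (l :* l))) refl n d l ⟩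
          n ² * (d * l ²)     ∎)
        where
        n≉0 : n ≉ 0#
        n≉0 n≈0 = n′≉0 (trans difference-law₁ n≈0)
      -- Here the difference has T-coordinate l and Z-coordinate p, so the relation is its w-value
      -- itself, and p ≠ 0 is the T-coordinate of `law₁` at the sum.
      cases (p′≉0 , w₀p′²≈) (inj₂ ≡.refl) =
        (λ (_ , _ , p≈0 , _) → p′≉0 (trans difference-law₂-Z p≈0)) ,
        trans (*-congˡ (²-cong (sym difference-law₂-Z)))
          (trans w₀p′²≈ (*-congˡ (²-cong difference-law₂-T)))

    -- C - D = 2(Z₁W₂ - W₁Z₂) and C + D = 2(W₁W₂ - Z₁Z₂), which are g d l and -g n with g = 2μ₁μ₂.
    sum-∝ : ∀ {w₀ W₁ Z₁ W₂ Z₂} → w (P₂ ⊝ P₁) ≈∙ fin w₀ → w₀ ≉ 0# →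
            coordinates P₁ ∝ W₁ , Z₁ → coordinates P₂ ∝ W₂ , Z₂ →
            let C = (W₁ + Z₁) * (W₂ - Z₂); D = (W₂ + Z₂) * (W₁ - Z₁) in
            coordinates (P₁ ⊕ P₂) ∝ (C - D) ² , (w₀ * (C + D) ²)
    -- `Vᵢ` and `Uᵢ` stand for Wᵢ and Zᵢ, as `Z₁` and `Z₂` already name coordinates of the points.
    sum-∝ {w₀} {V₁} {U₁} {V₂} {U₂} eq w₀≉0 (scaled μ₁ μ₁≉0 V₁≈ U₁≈) (scaled μ₂ μ₂≉0 V₂≈ U₂≈) =
      ≡.subst (λ V → V ∝ (C - D) ² , (w₀ * (C + D) ²))
        (≡.sym (⊕-law₁ P₁ P₂ (proj₁ (w₀p²≈dl² eq))))
        -- The scalar contains w₀ because d² l² = w₀ d p².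
        (scaled (g ² * w₀) (*-≉0 (²-≉0 g≉0) w₀≉0) W≈ Z≈)
      where
      C D g : Carrier
      C = (V₁ + U₁) * (V₂ - U₂)
      D = (V₂ + U₂) * (V₁ - U₁)
      g = μ₁ * μ₂ + μ₁ * μ₂

      g≉0 : g ≉ 0#
      g≉0 = double-≉0 odd (*-≉0 μ₁≉0 μ₂≉0)

      C-D : C - D ≈ g * (d * l)
      C-D = begin
        C - D
          ≈⟨ solve 4 (λ V₁ U₁ V₂ U₂ →
               (V₁ :+ U₁) :* (V₂ :- U₂) :- (V₂ :+ U₂) :* (V₁ :- U₁) :=
               (U₁ :* V₂ :- V₁ :* U₂) :+ (U₁ :* V₂ :- V₁ :* U₂)) refl V₁ U₁ V₂ U₂ ⟩
        (U₁ * V₂ - V₁ * U₂) + (U₁ * V₂ - V₁ * U₂)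
          ≈⟨ +-cong h h ⟩
        ((μ₁ * Z₁ ²) * (μ₂ * (d * T₂ ²)) - (μ₁ * (d * T₁ ²)) * (μ₂ * Z₂ ²)) +
        ((μ₁ * Z₁ ²) * (μ₂ * (d * T₂ ²)) - (μ₁ * (d * T₁ ²)) * (μ₂ * Z₂ ²))
          ≈⟨ solve 7 (λ μ₁ μ₂ d t₁ z₁ t₂ z₂ →
               let h = (μ₁ :* z₁) :* (μ₂ :* (d :* t₂)) :- (μ₁ :* (d :* t₁)) :* (μ₂ :* z₂) in
               h :+ h := (μ₁ :* μ₂ :+ μ₁ :* μ₂) :* (d :* (t₂ :* z₁ :- t₁ :* z₂)))
               refl μ₁ μ₂ d (T₁ ²) (Z₁ ²) (T₂ ²) (Z₂ ²) ⟩
        g * (d * l) ∎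
        where
        h : U₁ * V₂ - V₁ * U₂ ≈ (μ₁ * Z₁ ²) * (μ₂ * (d * T₂ ²)) - (μ₁ * (d * T₁ ²)) * (μ₂ * Z₂ ²)
        h = +-cong (*-cong U₁≈ V₂≈) (-‿cong (*-cong V₁≈ U₂≈))

      C+D : C + D ≈ g * - n
      C+D = begin
        C + D
          ≈⟨ solve 4 (λ V₁ U₁ V₂ U₂ →
               (V₁ :+ U₁) :* (V₂ :- U₂) :+ (V₂ :+ U₂) :* (V₁ :- U₁) :=
               (V₁ :* V₂ :- U₁ :* U₂) :+ (V₁ :* V₂ :- U₁ :* U₂)) refl V₁ U₁ V₂ U₂ ⟩
        (V₁ * V₂ - U₁ * U₂) + (V₁ * V₂ - U₁ * U₂)
          ≈⟨ +-cong h h ⟩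
        ((μ₁ * (d * T₁ ²)) * (μ₂ * (d * T₂ ²)) - (μ₁ * Z₁ ²) * (μ₂ * Z₂ ²)) +
        ((μ₁ * (d * T₁ ²)) * (μ₂ * (d * T₂ ²)) - (μ₁ * Z₁ ²) * (μ₂ * Z₂ ²))
          ≈⟨ solve 7 (λ μ₁ μ₂ d T₁ Z₁ T₂ Z₂ →
               let h = (μ₁ :* (d :* (T₁ :* T₁))) :* (μ₂ :* (d :* (T₂ :* T₂)))
                         :- (μ₁ :* (Z₁ :* Z₁)) :* (μ₂ :* (Z₂ :* Z₂)) in
               h :+ h := (μ₁ :* μ₂ :+ μ₁ :* μ₂) :*
                 (:- ((Z₁ :* Z₂ :+ d :* T₁ :* T₂) :* (Z₁ :* Z₂ :- d :* T₁ :* T₂))))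
               refl μ₁ μ₂ d T₁ Z₁ T₂ Z₂ ⟩
        g * - n ∎
        where
        h : V₁ * V₂ - U₁ * U₂ ≈ (μ₁ * (d * T₁ ²)) * (μ₂ * (d * T₂ ²)) - (μ₁ * Z₁ ²) * (μ₂ * Z₂ ²)
        h = +-cong (*-cong V₁≈ V₂≈) (-‿cong (*-cong U₁≈ U₂≈))

      W≈ : (C - D) ² ≈ g ² * w₀ * (d * p ²)
      W≈ = begin
        (C - D) ²                  ≈⟨ ²-cong C-D ⟩
        (g * (d * l)) ²            ≈⟨ solve 3 (λ g d l → (g :* (d :* l)) :* (g :* (d :* l)) := (g :* g) :* d :* (d :* (l :* l))) refl g d l ⟩
        g ² * d * (d * l ²)        ≈⟨ *-congˡ (proj₂ (w₀p²≈dl² eq)) ⟨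
        g ² * d * (w₀ * p ²)       ≈⟨ solve 4 (λ g d w p → (g :* d) :* (w :* p) := g :* w :* (d :* p)) refl (g ²) d w₀ (p ²) ⟩
        g ² * w₀ * (d * p ²)       ∎

      Z≈ : w₀ * (C + D) ² ≈ g ² * w₀ * n ²
      Z≈ = begin
        w₀ * (C + D) ²    ≈⟨ *-congˡ (²-cong C+D) ⟩
        w₀ * (g * - n) ²  ≈⟨ solve 3 (λ g w n → w :* ((g :* (:- n)) :* (g :* (:- n))) := (g :* g) :* w :* (n :* n)) refl g w₀ n ⟩
        g ² * w₀ * n ²    ∎

  -- The three doubling formulas.

  module Doubling (P : Point) {W₁ Z₁ : Carrier} (P∝ : coordinates P ∝ W₁ , Z₁) where
    open Point P using (X; Y; T; Z; onCurve)
    open _∝_,_ P∝ using (W≈; Z≈) renaming (factor to μ; factor≉0 to μ≉0)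

    A B x y κ E : Carrier
    A = W₁ + Z₁
    B = W₁ - Z₁
    x = A ²
    y = B ²
    E = x - y
    κ = e / four

    private
      τ ζ s α : Carrier
      τ = d * T ²
      ζ = Z ²
      s = X * Y
      α = Y ² - a * X ²

    x≈ : x ≈ μ ² * (τ + ζ) ²
    x≈ = trans (²-cong (+-cong W≈ Z≈))
      (solve 3 (λ μ τ ζ → (μ :* τ :+ μ :* ζ) :* (μ :* τ :+ μ :* ζ) := (μ :* μ) :* ((τ :+ ζ) :* (τ :+ ζ))) refl μ τ ζ)

    y≈ : y ≈ μ ² * (τ - ζ) ²
    y≈ = trans (²-cong (+-cong W≈ (-‿cong Z≈)))
      (solve 3 (λ μ τ ζ → (μ :* τ :- μ :* ζ) :* (μ :* τ :- μ :* ζ) := (μ :* μ) :* ((τ :- ζ) :* (τ :- ζ))) refl μ τ ζ)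

    -- Added to itself, this is the term 4 k (XY)², needed for k = d, κ d and a.
    2s² : Carrier → Carrier
    2s² k = k * s ² + k * s ²

    -- (τ + ζ)² - (τ - ζ)² = 4τζ = 4d(ZT)², and ZT = XY.
    E≈ : E ≈ μ ² * (2s² d + 2s² d)
    E≈ = begin
      x - y
        ≈⟨ +-cong x≈ (-‿cong y≈) ⟩
      μ ² * (τ + ζ) ² - μ ² * (τ - ζ) ²
        ≈⟨ solve 4 (λ μ d T Z →
             let τ = d :* (T :* T); ζ = Z :* Z; h = d :* ((Z :* T) :* (Z :* T)) in
             μ :* ((τ :+ ζ) :* (τ :+ ζ)) :- μ :* ((τ :- ζ) :* (τ :- ζ)) :=
             μ :* ((h :+ h) :+ (h :+ h))) refl (μ ²) d T Z ⟩
      μ ² * ((d * (Z * T) ² + d * (Z * T) ²) + (d * (Z * T) ² + d * (Z * T) ²))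
        ≈⟨ *-congˡ (+-cong (+-cong h h) (+-cong h h)) ⟩
      μ ² * (2s² d + 2s² d) ∎
      where
      h : d * (Z * T) ² ≈ d * s ²
      h = *-congˡ (²-cong (sym (proj₂ onCurve)))

    -- By the curve equation A² is μ²(aX² + Y²)², and κE is 4aμ²(XY)²; the difference is μ² times
    -- the square of Y² - aX².
    x-κE≈ : x - κ * E ≈ μ ² * α ²
    x-κE≈ = begin
      x - κ * E
        ≈⟨ +-cong x≈ (-‿cong (*-congˡ E≈)) ⟩
      μ ² * (τ + ζ) ² - κ * (μ ² * (2s² d + 2s² d))
        ≈⟨ solve 5 (λ μ S κ d s →
             let h = d :* s; h′ = κ :* d :* s in
             μ :* S :- κ :* (μ :* ((h :+ h) :+ (h :+ h))) :=
             μ :* (S :- ((h′ :+ h′) :+ (h′ :+ h′)))) refl (μ ²) ((τ + ζ) ²) κ d (s ²) ⟩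
      μ ² * ((τ + ζ) ² - (2s² (κ * d) + 2s² (κ * d)))
        ≈⟨ *-congˡ (+-cong (²-cong (trans (+-comm τ ζ) (sym (proj₁ onCurve))))
             (-‿cong (+-cong (+-cong h h) (+-cong h h)))) ⟩
      μ ² * ((a * X ² + Y ²) ² - (2s² a + 2s² a))
        ≈⟨ *-congˡ (solve 3 (λ a X Y →
             let S = a :* (X :* X) :+ Y :* Y; h = a :* ((X :* Y) :* (X :* Y)); α = Y :* Y :- a :* (X :* X) in
             S :* S :- ((h :+ h) :+ (h :+ h)) := α :* α) refl a X Y) ⟩
      μ ² * α ² ∎
      where
      h : κ * d * s ² ≈ a * s ²
      h = *-congʳ e/4*d≈a

    -- `law₁` gives the double T-coordinate 2XY(Y² - aX²) and Z-coordinate Z⁴ - d²T⁴. The first is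
    -- matched by `E≈` and `x-κE≈`, the second by x y = μ⁴(τ² - ζ²)².
    double-∝ : coordinates (P ⊕ P) ∝ (E * (x - κ * E)) , (x * y)
    double-∝ = ≡.subst (λ V → V ∝ (E * (x - κ * E)) , (x * y))
      (≡.sym (⊕-law₁ P P (law₁-self-nonzero P)))
      (scaled (μ ² * μ ²) (*-≉0 (²-≉0 μ≉0) (²-≉0 μ≉0)) W₄≈ Z₄≈)
      where
      W₄≈ : E * (x - κ * E) ≈ μ ² * μ ² * (d * ((X * Y + Y * X) * (Y * Y - a * X * X)) ²)
      W₄≈ = trans (*-cong E≈ x-κE≈) (solve 5 (λ μ a d X Y →
        let h = d :* ((X :* Y) :* (X :* Y)); α = Y :* Y :- a :* (X :* X)
            T₃ = (X :* Y :+ Y :* X) :* (Y :* Y :- a :* X :* X) in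
        (μ :* ((h :+ h) :+ (h :+ h))) :* (μ :* (α :* α)) := μ :* μ :* (d :* (T₃ :* T₃)))
        refl (μ ²) a d X Y)

      Z₄≈ : x * y ≈ μ ² * μ ² * ((Z * Z + d * T * T) * (Z * Z - d * T * T)) ²
      Z₄≈ = trans (*-cong x≈ y≈) (solve 4 (λ μ d T Z →
        let τ = d :* (T :* T); ζ = Z :* Z
            Z₃ = (Z :* Z :+ d :* T :* T) :* (Z :* Z :- d :* T :* T) in
        (μ :* ((τ :+ ζ) :* (τ :+ ζ))) :* (μ :* ((τ :- ζ) :* (τ :- ζ))) := μ :* μ :* (Z₃ :* Z₃))
        refl (μ ²) d T Z)

    -- Since E² = x² + y² - 2xy, F′ is 2xy, and 2x² - 2xy = 2xE; the pair is twice that of (i).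
    double-∝-ii : let F′ = (x ² + y ²) - E ²; H = x ² - κ * E ² in
                  coordinates (P ⊕ P) ∝ ((H + H) - F′) , F′
    double-∝-ii = ∝-rescale (double-≉0 odd λ 1≈0 → 0≉1 (sym 1≈0))
      (trans (solve 3 (λ x y κ →
        let E = x :- y; F = (x :* x :+ y :* y) :- E :* E; H = x :* x :- κ :* (E :* E); W = E :* (x :- κ :* E) in
        (H :+ H) :- F := W :+ W) refl x y κ) (x+x≈2*x _))
      (trans (solve 2 (λ x y →
        let E = x :- y; F = (x :* x :+ y :* y) :- E :* E in
        F := x :* y :+ x :* y) refl x y) (x+x≈2*x _))
      double-∝

    -- Put c′ = r² - 1 = -4/e, so c′κ = -1. Then S′ = 4xy and T′ = 4r²xy, hence T′ - S′ = 4c′xy; and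
    -- 2G - S′ - T′ = 4E(r²x - y) with r²x - y = c′x + E = c′(x - κE). The pair is 4c′ times that of
    -- (i).
    double-∝-iii : IsNonzeroSquare (e * (e - four)) → ∀ r → r ² ≈ (e - four) / e →
                   let H₁ = (r * x + y) ²; H₂ = (r * x - y) ²
                       G = H₁ + H₂; K = H₁ - H₂; S′ = 1# / r * K; T′ = r * K in
                   coordinates (P ⊕ P) ∝ ((G + G) - S′ - T′) , (T′ - S′)
    double-∝-iii (e[e-4]≉0 , _) r r²≈ = ∝-rescale (double-≉0 odd (double-≉0 odd c≉0))
      (begin
        (G + G) - S′ - T′
          ≈⟨ +-congʳ (+-congˡ (-‿cong S′≈)) ⟩
        (G + G) - 4xy - T′
          ≈⟨ solve 3 (λ r x y →
               let H₁ = (r :* x :+ y) :* (r :* x :+ y); H₂ = (r :* x :- y) :* (r :* x :- y)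
                   G = H₁ :+ H₂; 4xy = (x :* y :+ x :* y) :+ (x :* y :+ x :* y)
                   h = (x :- y) :* ((r :* r :* x :- x) :- (:- (x :- y))) in
               (G :+ G) :- 4xy :- r :* (H₁ :- H₂) := (h :+ h) :+ (h :+ h)) refl r x y ⟩
        (h + h) + (h + h)
          ≈⟨ +-cong (+-cong h≈ h≈) (+-cong h≈ h≈) ⟩
        (h′ + h′) + (h′ + h′)
          ≈⟨ solve 4 (λ c E x κE → let h = E :* (c :* x :- c :* κE) in
               (h :+ h) :+ (h :+ h) := ((c :+ c) :+ (c :+ c)) :* (E :* (x :- κE))) refl c′ E x (κ * E) ⟩
        4c * (E * (x - κ * E)) ∎)
      (begin
        T′ - S′
          ≈⟨ +-congˡ (-‿cong S′≈) ⟩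
        T′ - 4xy
          ≈⟨ solve 3 (λ r x y →
               let H₁ = (r :* x :+ y) :* (r :* x :+ y); H₂ = (r :* x :- y) :* (r :* x :- y)
                   4xy = (x :* y :+ x :* y) :+ (x :* y :+ x :* y)
                   k = (r :* r :* x :- x) :* y in
               r :* (H₁ :- H₂) :- 4xy := (k :+ k) :+ (k :+ k)) refl r x y ⟩
        (k + k) + (k + k)
          ≈⟨ +-cong (+-cong k≈ k≈) (+-cong k≈ k≈) ⟩
        (c′ * x * y + c′ * x * y) + (c′ * x * y + c′ * x * y)
          ≈⟨ solve 3 (λ c x y → let k = c :* x :* y in
               (k :+ k) :+ (k :+ k) := ((c :+ c) :+ (c :+ c)) :* (x :* y)) refl c′ x y ⟩
        4c * (x * y) ∎)
      double-∝
      where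
      H₁ H₂ G K S′ T′ 4xy c′ 4c h h′ k : Carrier
      H₁ = (r * x + y) ²
      H₂ = (r * x - y) ²
      G  = H₁ + H₂
      K  = H₁ - H₂
      S′ = 1# / r * K
      T′ = r * K
      4xy = (x * y + x * y) + (x * y + x * y)
      c′ = r ² - 1#
      4c = (c′ + c′) + (c′ + c′)
      -- The factor r²x - y is written as (r²x - x) + E, so that c′ can be drawn out of both terms.
      h  = E * ((r ² * x - x) - - E)
      h′ = E * (c′ * x - c′ * (κ * E))
      k  = (r ² * x - x) * y

      e≉0 : e ≉ 0#
      e≉0 e≈0 = e[e-4]≉0 (0* e≈0)

      r²e≈ : r ² * e ≈ e - four
      r²e≈ = trans (*-congʳ r²≈) (/-*-cancel e≉0)

      -- r = 0 would give e = 4, contrary to e(e - 4) ≠ 0.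
      r≉0 : r ≉ 0#
      r≉0 r≈0 = e[e-4]≉0 (*0 (trans (sym r²e≈) (0* (0* r≈0))))

      c′κ≈-1 : c′ * κ ≈ - 1#
      c′κ≈-1 = *-cancelˡ four≉0 (begin
        four * (c′ * κ)
          ≈⟨ solve 4 (λ f r o κ → f :* ((r :- o) :* κ) := r :* (κ :* f) :- o :* (κ :* f)) refl four (r ²) 1# κ ⟩
        r ² * (κ * four) - 1# * (κ * four)
          ≈⟨ +-cong (*-congˡ (/-*-cancel four≉0)) (-‿cong (trans (*-identityˡ _) (/-*-cancel four≉0))) ⟩
        r ² * e - e
          ≈⟨ +-congʳ r²e≈ ⟩
        (e - four) - e
          ≈⟨ solve 2 (λ e f → (e :- f) :- e := :- f) refl e four ⟩
        - four
          ≈⟨ -‿cong (*-identityʳ four) ⟨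
        - (four * 1#)
          ≈⟨ solve 2 (λ f o → :- (f :* o) := f :* (:- o)) refl four 1# ⟩
        four * - 1# ∎)

      c≉0 : c′ ≉ 0#
      c≉0 c′≈0 = 0≉1 (sym (neg-zero (trans (sym c′κ≈-1) (0* c′≈0))))

      S′≈ : S′ ≈ 4xy
      S′≈ = begin
        1# / r * K
          ≈⟨ solve 4 (λ i r x y →
               let H₁ = (r :* x :+ y) :* (r :* x :+ y); H₂ = (r :* x :- y) :* (r :* x :- y)
                   4xy = (x :* y :+ x :* y) :+ (x :* y :+ x :* y) in
               i :* (H₁ :- H₂) := i :* r :* 4xy) refl (1# / r) r x y ⟩
        1# / r * r * 4xy  ≈⟨ *-congʳ (/-*-cancel r≉0) ⟩
        1# * 4xy          ≈⟨ *-identityˡ 4xy ⟩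
        4xy               ∎

      c′x≈ : r ² * x - x ≈ c′ * x
      c′x≈ = begin
        r ² * x - x         ≈⟨ +-congˡ (-‿cong (*-identityˡ x)) ⟨
        r ² * x - 1# * x    ≈⟨ solve 3 (λ r o x → r :* x :- o :* x := (r :- o) :* x) refl (r ²) 1# x ⟩
        c′ * x              ∎

      -E≈ : - E ≈ c′ * (κ * E)
      -E≈ = begin
        - E              ≈⟨ -‿cong (*-identityˡ E) ⟨
        - (1# * E)       ≈⟨ solve 2 (λ o E → :- (o :* E) := (:- o) :* E) refl 1# E ⟩
        - 1# * E         ≈⟨ *-congʳ c′κ≈-1 ⟨
        c′ * κ * E       ≈⟨ *-assoc c′ κ E ⟩
        c′ * (κ * E)     ∎

      h≈ : h ≈ h′
      h≈ = *-congˡ (+-cong c′x≈ (-‿cong -E≈))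

      k≈ : k ≈ c′ * x * y
      k≈ = *-congʳ c′x≈

mainTheorem1 :
  ∀ {c ℓ} →
  (∀ (F : FiniteField c ℓ) → let open FiniteField F in
   (odd : OddCharacteristic) (a d : Carrier) (nonsingular : a * d * (a - d) ≉ 0#) →
   let open TwistedEdwards F odd a d nonsingular
       open Evaluation F
       four = 4 ·ℕ 1#
   in
   (IsNonzeroSquare (e * (e - four)) ⇔ χ (a * (a - d)) ≡ 1ℤ) ×
   (∀ (P₁ P₂ : Point) (w₀ W₁ Z₁ W₂ Z₂ : Carrier) →
    w (P₂ ⊝ P₁) ≈∙ fin w₀ → w₀ ≉ 0# →
    ¬ (W₁ ≈ 0# × Z₁ ≈ 0#) → ¬ (W₂ ≈ 0# × Z₂ ≈ 0#) →
    w P₁ ≐ W₁ ÷ Z₁ → w P₂ ≐ W₂ ÷ Z₂ →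
    let inputs = w₀ ∷ W₁ ∷ Z₁ ∷ W₂ ∷ Z₂ ∷ []
        W₃ = ⟦ DifferentialAddition.W₃ ⟧ [] inputs
        Z₃ = ⟦ DifferentialAddition.Z₃ ⟧ [] inputs
        Correct = λ W₄ Z₄ →
          w (P₁ ⊕ P₁) ≐ W₄ ÷ Z₄ × ¬ (W₄ ≈ 0# × Z₄ ≈ 0#) ×
          w (P₁ ⊕ P₂) ≐ W₃ ÷ Z₃ × ¬ (W₃ ≈ 0# × Z₃ ≈ 0#)
    in
    Correct (⟦ Doubling-i.W₄ ⟧ (e / four ∷ []) inputs) (⟦ Doubling-i.Z₄ ⟧ (e / four ∷ []) inputs) ×
    Correct (⟦ Doubling-ii.W₄ ⟧ (e / four ∷ []) inputs) (⟦ Doubling-ii.Z₄ ⟧ (e / four ∷ []) inputs) ×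
    (IsNonzeroSquare (e * (e - four)) → ∀ r → r ² ≈ (e - four) / e →
     Correct (⟦ Doubling-iii.W₄ ⟧ (r ∷ 1# / r ∷ []) inputs) (⟦ Doubling-iii.Z₄ ⟧ (r ∷ 1# / r ∷ []) inputs))))
  ×
  (cost (DifferentialAddition.W₃ ∷ DifferentialAddition.Z₃ ∷ Doubling-i.W₄ ∷ Doubling-i.Z₄ ∷ [])
     ≡ 5 𝐌+ 4 𝐒+ 1 𝐃 ×
   cost (DifferentialAddition.W₃ ∷ DifferentialAddition.Z₃ ∷ Doubling-ii.W₄ ∷ Doubling-ii.Z₄ ∷ [])
     ≡ 3 𝐌+ 7 𝐒+ 1 𝐃 ×
   cost (DifferentialAddition.W₃ ∷ DifferentialAddition.Z₃ ∷ Doubling-iii.W₄ ∷ Doubling-iii.Z₄ ∷ [])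
     ≡ 3 𝐌+ 6 𝐒+ 3 𝐃)
-- The costs are closed terms, checked by evaluation.
mainTheorem1 = field-case , ≡.refl , ≡.refl , ≡.refl
  where
  field-case : _
  field-case F odd a d nonsingular = square-criterion , λ P₁ P₂ w₀ W₁ Z₁ W₂ Z₂ w₀≈ w₀≉0 _ _ w₁≐ w₂≐ →
    let P₁∝ = ≐⇒∝ P₁ w₁≐
        open Doubling P₁ P₁∝
        -- The cases differ only in the pair for the double; the claim on P₁ + P₂ is shared.
        correct = λ {W} {Z} (4∝ : coordinates (P₁ ⊕ P₁) ∝ W , Z) →
          let 3∝ = Addition.sum-∝ P₁ P₂ w₀≈ w₀≉0 P₁∝ (≐⇒∝ P₂ w₂≐)
              4≐ = ∝⇒≐ (P₁ ⊕ P₁) 4∝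
              3≐ = ∝⇒≐ (P₁ ⊕ P₂) 3∝
          in 4≐ , ≐⇒nonzero (w (P₁ ⊕ P₁)) 4≐ , 3≐ , ≐⇒nonzero (w (P₁ ⊕ P₂)) 3≐
    in correct double-∝ , correct double-∝-ii , λ sq r r²≈ → correct (double-∝-iii sq r r²≈)
    where
    open TwistedEdwards F odd a d nonsingular
    open Point using (coordinates)
    open TwistedEdwardsProperties F odd a d nonsingular
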